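{- There exists an absolute constant $c$ such that the following holds. Let $\mathbb{F}$ be an arbitrary field and let $\mathfrak{L}_1,\mathfrak{L}_2,\mathfrak{L}_3$ be finite collections of $L_1$, $L_2$ and $L_3$ lines in $\mathbb{F}^3$, respectively. Then $$|J(\mathfrak{L}_1,\mathfrak{L}_2,\mathfrak{L}_3)|\le c\,(L_1L_2L_3)^{1/2}.$$
   Context: For finite collections $\mathfrak{L}_1,\ldots,\mathfrak{L}_n$ of lines in $\mathbb{F}^n$, a point $x\in\mathbb{F}^n$ is a multijoint formed by them if for each $i=1,\ldots,n$ there is a line $l_i\in\mathfrak{L}_i$ passing through $x$ such that the directions of $l_1,\ldots,l_n$ span $\mathbb{F}^n$. $J(\mathfrak{L}_1,\ldots,\mathfrak{L}_n)$ denotes the set of such multijoints. -}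

module Defs where

open import Level using (Level; _⊔_; Setω)
open import Data.Nat using (ℕ)
open import Data.Fin using (Fin; zero; suc)
open import Data.Product using (Σ; ∃; _×_; _,_)
open import Data.List using (List; length)
open import Data.List.Relation.Unary.All using (All)
open import Data.List.Membership.Propositional using (_∈_)
open import Data.List.Relation.Unary.AllPairs using (AllPairs)
open import Relation.Nullary using (¬_)
open import Algebra.Bundles using (CommutativeRing)

record Field (a ℓ : Level) : Set (Level.suc (a ⊔ ℓ)) where
  field
    commRing  : CommutativeRing a ℓ
  open CommutativeRing commRing public
  field
    0≉1       : ¬ (0# ≈ 1#)
    inverse   : ∀ x → ¬ (x ≈ 0#) → Σ Carrier λ y → x * y ≈ 1#

module Geometry {a ℓ : Level} (F : Field a ℓ) where
  open Field F

  Vec3 : Set a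
  Vec3 = Fin 3 → Carrier

  _≋_ : Vec3 → Vec3 → Set ℓ
  u ≋ v = ∀ i → u i ≈ v i

  _⊕_ : Vec3 → Vec3 → Vec3
  (u ⊕ v) i = u i + v i

  _⊙_ : Carrier → Vec3 → Vec3
  (t ⊙ v) i = t * v i

  record Line : Set (a ⊔ ℓ) where
    constructor line
    field
      base      : Vec3
      dir       : Vec3
      dir≠0     : ¬ (∀ i → dir i ≈ 0#)
  open Line public

  _∈L_ : Vec3 → Line → Set (a ⊔ ℓ)
  x ∈L l = Σ Carrier λ t → x ≋ (base l ⊕ (t ⊙ dir l))

  Spans : Vec3 → Vec3 → Vec3 → Set (a ⊔ ℓ)
  Spans u v w = ∀ (z : Vec3) → Σ Carrier λ α → Σ Carrier λ β → Σ Carrier λ γ →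
    z ≋ ((α ⊙ u) ⊕ ((β ⊙ v) ⊕ (γ ⊙ w)))

  IsMultijoint : List Line → List Line → List Line → Vec3 → Set (a ⊔ ℓ)
  IsMultijoint 𝔏₁ 𝔏₂ 𝔏₃ x =
    Σ Line λ l₁ → Σ Line λ l₂ → Σ Line λ l₃ →
      l₁ ∈ 𝔏₁ × l₂ ∈ 𝔏₂ × l₃ ∈ 𝔏₃
      × x ∈L l₁ × x ∈L l₂ × x ∈L l₃ × Spans (dir l₁) (dir l₂) (dir l₃)

-- Universe-polymorphic existential over ℕ (the statement quantifies over
-- fields of all universe levels, so it lives in Setω).
record ∃ℕω (P : ℕ → Setω) : Setω where
  constructor _,ω_
  field
    witness : ℕ
    proof   : P witness

{-# OPTIONS --safe #-}
module Submission where

-- Discard lines, together with the joints assigned to them, until every line of family k that is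
-- still used carries more than J / (4 Lₖ) joints; since at most 3J/4 joints are lost, some remain.
-- Consider polynomials g of degree < J in each of the three variables, a space of dimension J³.
-- If J² > 1728 L₁L₂L₃, there are fewer than J³ linear conditions saying that, at every remaining
-- joint, in the coordinates given by its three lines, the coefficients of x₁^a₁ x₂^a₂ x₃^a₃ with all
-- aₖ < 12 Lₖ vanish; so some g ≠ 0 satisfies them. But then g vanishes at every joint to order r for
-- all r, by induction on r: a coefficient of total order r with aₖ ≥ 12 Lₖ is a coefficient of a
-- univariate polynomial along the k-th line, of degree < 3J, which by induction vanishes to order aₖ
-- at each of the more than J / (4 Lₖ) joints of that line, hence is zero. So g = 0.
--
-- Equality in the field is not decidable, but the conclusion is, so the case distinctions in the
-- Gaussian elimination are made under a double negation.

open import Defs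
open import Level using (Level; _⊔_)
open import Data.Nat as ℕ using (ℕ; zero; suc; s≤s; z≤n; _^_)
import Data.Nat.Properties as ℕ
open import Data.Fin as Fin using (Fin; zero; suc; toℕ; combine; remQuot)
open import Data.Fin.Properties as Fin using (combine-remQuot; toℕ≤pred[n])
open import Data.Vec as Vec using (Vec; []; _∷_; insertAt; removeAt)
open import Data.Vec.Properties using (insertAt-removeAt)
import Data.Vec.Functional as Vector
open import Data.List as List using (List; []; _∷_; length; filter; map)
open import Data.List.Properties using (length-map)
open import Data.List.Membership.Propositional using (_∈_)
open import Data.List.Membership.Propositional.Properties
open import Data.List.Relation.Unary.All as All using (All; []; _∷_)
import Data.List.Relation.Unary.All.Properties as All
open import Data.List.Relation.Unary.AllPairs as AllPairs using (AllPairs; []; _∷_)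
import Data.List.Relation.Unary.AllPairs.Properties as AllPairs
open import Data.Product using (_×_; _,_; proj₁; proj₂; Σ)
open import Data.Sum using (_⊎_; inj₁; inj₂)
open import Data.Unit using (⊤; tt)
open import Function using (_∘_; id)
open import Relation.Nullary using (¬_; Dec; yes; no; ¬?; contradiction)
open import Relation.Nullary.Decidable using (¬¬-excluded-middle; decidable-stable)
open import Relation.Unary using (Pred; Decidable)
open import Relation.Binary using (Rel; Setoid)
open import Relation.Binary.PropositionalEquality as ≡ using (_≡_)

-- Polynomials in n variables, compared by their coefficients.

module Polynomials {a ℓ : Level} (F : Field a ℓ) where
  open Field F hiding (zero)
  open import Algebra.Properties.Ring ring using (-1*x≈-x; x+x≈x⇒x≈0; -‿involutive)
  open import Algebra.Properties.AbelianGroup +-abelianGroup using (inverseˡ-unique)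
  open import Algebra.Properties.CommutativeSemigroup
    +-commutativeSemigroup using (interchange)

  -- cons f g stands for f + x₀ g, where f does not involve x₀; trailing zeros are allowed.
  data Poly : ℕ → Set a where
    con  : Carrier → Poly 0
    nil  : ∀ {n} → Poly (suc n)
    cons : ∀ {n} → Poly n → Poly (suc n) → Poly (suc n)

  coef : ∀ {n} → Poly n → Vec ℕ n → Carrier
  coef (con c)    []          = c
  coef nil        (_ ∷ _)     = 0#
  coef (cons f g) (zero ∷ e)  = coef f e
  coef (cons f g) (suc k ∷ e) = coef g (k ∷ e)

  infix 4 _≐_
  -- Trailing zeros make the representation non-unique, so equality has to be coefficientwise. As a
  -- record it lets `f` and `g` be inferred from a proof.
  record _≐_ {n} (f g : Poly n) : Set ℓ where
    constructor mk≐
    field at : ∀ e → coef f e ≈ coef g e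
  open _≐_ public

  ≐-setoid : ℕ → Setoid a ℓ
  ≐-setoid n = record
    { Carrier = Poly n
    ; _≈_ = _≐_
    ; isEquivalence = record
      { refl = mk≐ λ _ → refl
      ; sym = λ p → mk≐ λ e → sym (at p e)
      ; trans = λ p q → mk≐ λ e → trans (at p e) (at q e)
      }
    }

  module _ {n : ℕ} where
    open Setoid (≐-setoid n) public using () renaming (refl to ≐-refl; sym to ≐-sym; trans to ≐-trans)

  𝟘 : ∀ {n} → Poly n
  𝟘 {zero}  = con 0#
  𝟘 {suc n} = nil

  𝟙 : ∀ {n} → Poly n
  𝟙 {zero}  = con 1#
  𝟙 {suc n} = cons 𝟙 nil

  infixl 6 _⊞_
  _⊞_ : ∀ {n} → Poly n → Poly n → Poly n
  con c      ⊞ con d      = con (c + d)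
  nil        ⊞ g          = g
  cons f f′  ⊞ nil        = cons f f′
  cons f f′  ⊞ cons g g′  = cons (f ⊞ g) (f′ ⊞ g′)

  infixr 7 _•_
  _•_ : ∀ {n} → Carrier → Poly n → Poly n
  c • con d     = con (c * d)
  c • nil       = nil
  c • cons f f′ = cons (c • f) (c • f′)

  -- Multiplication by the `i`-th variable. General products are never formed: linear combinations
  -- and the operators `X i` suffice for substitutions.
  X : ∀ {n} → Fin n → Poly n → Poly n
  X zero    f           = cons 𝟘 f
  X (suc i) nil         = nil
  X (suc i) (cons f f′) = cons (X i f) (X (suc i) f′)

  coef-𝟘 : ∀ {n} (e : Vec ℕ n) → coef 𝟘 e ≈ 0#
  coef-𝟘 []      = refl
  coef-𝟘 (_ ∷ _) = refl

  coef-⊞ : ∀ {n} (f g : Poly n) e → coef (f ⊞ g) e ≈ coef f e + coef g e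
  coef-⊞ (con c)     (con d)     []          = refl
  coef-⊞ nil         g           (k ∷ e)     = sym (+-identityˡ _)
  coef-⊞ (cons f f′) nil         (zero ∷ e)  = sym (+-identityʳ _)
  coef-⊞ (cons f f′) nil         (suc k ∷ e) = sym (+-identityʳ _)
  coef-⊞ (cons f f′) (cons g g′) (zero ∷ e)  = coef-⊞ f g e
  coef-⊞ (cons f f′) (cons g g′) (suc k ∷ e) = coef-⊞ f′ g′ (k ∷ e)

  coef-• : ∀ {n} c (f : Poly n) e → coef (c • f) e ≈ c * coef f e
  coef-• c (con d)     []          = refl
  coef-• c nil         (k ∷ e)     = sym (zeroʳ c)
  coef-• c (cons f f′) (zero ∷ e)  = coef-• c f e
  coef-• c (cons f f′) (suc k ∷ e) = coef-• c f′ (k ∷ e)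

  ⊞-cong : ∀ {n} {f f′ g g′ : Poly n} → f ≐ f′ → g ≐ g′ → f ⊞ g ≐ f′ ⊞ g′
  ⊞-cong {f = f} {f′} {g} {g′} p q = mk≐ λ e →
    trans (coef-⊞ f g e) (trans (+-cong (at p e) (at q e)) (sym (coef-⊞ f′ g′ e)))

  •-cong : ∀ {n} {c d} {f g : Poly n} → c ≈ d → f ≐ g → c • f ≐ d • g
  •-cong {c = c} {d} {f} {g} p q = mk≐ λ e →
    trans (coef-• c f e) (trans (*-cong p (at q e)) (sym (coef-• d g e)))

  ⊞-identityʳ : ∀ {n} (f : Poly n) → f ⊞ 𝟘 ≐ f
  ⊞-identityʳ f = mk≐ λ e → trans (coef-⊞ f 𝟘 e) (trans (+-congˡ (coef-𝟘 e)) (+-identityʳ _))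

  ⊞-identityˡ : ∀ {n} (f : Poly n) → 𝟘 ⊞ f ≐ f
  ⊞-identityˡ f = mk≐ λ e → trans (coef-⊞ 𝟘 f e) (trans (+-congʳ (coef-𝟘 e)) (+-identityˡ _))

  ⊞-interchange : ∀ {n} (f g h k : Poly n) → (f ⊞ g) ⊞ (h ⊞ k) ≐ (f ⊞ h) ⊞ (g ⊞ k)
  ⊞-interchange f g h k = mk≐ λ e → trans (coef-⊞₄ f g h k e)
    (trans (interchange _ _ _ _) (sym (coef-⊞₄ f h g k e)))
    where
    coef-⊞₄ : ∀ f g h k e → coef ((f ⊞ g) ⊞ (h ⊞ k)) e ≈ (coef f e + coef g e) + (coef h e + coef k e)
    coef-⊞₄ f g h k e = trans (coef-⊞ (f ⊞ g) (h ⊞ k) e) (+-cong (coef-⊞ f g e) (coef-⊞ h k e))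

  ⊞-congˡ : ∀ {n} (f : Poly n) {g g′} → g ≐ g′ → f ⊞ g ≐ f ⊞ g′
  ⊞-congˡ f = ⊞-cong (≐-refl {x = f})

  •-zeroˡ : ∀ {n} {c} (f : Poly n) → c ≈ 0# → c • f ≐ 𝟘
  •-zeroˡ {c = c} f p = mk≐ λ e → trans (coef-• c f e) (trans (*-congʳ p) (trans (zeroˡ _) (sym (coef-𝟘 e))))

  •-zeroʳ : ∀ {n} c → c • 𝟘 {n} ≐ 𝟘
  •-zeroʳ c = mk≐ λ e → trans (coef-• c 𝟘 e) (trans (*-congˡ (coef-𝟘 e)) (trans (zeroʳ c) (sym (coef-𝟘 e))))

  •-distribˡ : ∀ {n} c (f g : Poly n) → c • (f ⊞ g) ≐ c • f ⊞ c • g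
  •-distribˡ c f g = mk≐ λ e → trans (coef-• c (f ⊞ g) e) (trans (*-congˡ (coef-⊞ f g e))
    (trans (distribˡ c _ _) (sym (trans (coef-⊞ (c • f) (c • g) e) (+-cong (coef-• c f e) (coef-• c g e))))))

  •-distribʳ : ∀ {n} c d (f : Poly n) → (c + d) • f ≐ c • f ⊞ d • f
  •-distribʳ c d f = mk≐ λ e → trans (coef-• (c + d) f e) (trans (distribʳ _ c d)
    (sym (trans (coef-⊞ (c • f) (d • f) e) (+-cong (coef-• c f e) (coef-• d f e)))))

  •-assoc : ∀ {n} c d (f : Poly n) → (c * d) • f ≐ c • (d • f)
  •-assoc c d f = mk≐ λ e → trans (coef-• (c * d) f e) (trans (*-assoc c d _)
    (sym (trans (coef-• c (d • f) e) (*-congˡ (coef-• d f e)))))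

  •-comm : ∀ {n} c d (f : Poly n) → c • (d • f) ≐ d • (c • f)
  •-comm c d f = ≐-trans (≐-sym (•-assoc c d f)) (≐-trans (•-cong (*-comm c d) ≐-refl) (•-assoc d c f))

  cons-cong : ∀ {n} {f g : Poly n} {f′ g′} → f ≐ g → f′ ≐ g′ → cons f f′ ≐ cons g g′
  cons-cong p q = mk≐ λ { (zero ∷ e) → at p e ; (suc k ∷ e) → at q (k ∷ e) }

  record IsLinear {m n} (ψ : Poly m → Poly n) : Set (a ⊔ ℓ) where
    field
      cong : ∀ {f g} → f ≐ g → ψ f ≐ ψ g
      add  : ∀ f g → ψ (f ⊞ g) ≐ ψ f ⊞ ψ g
      scal : ∀ c f → ψ (c • f) ≐ c • ψ f

    null : ψ 𝟘 ≐ 𝟘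
    null = mk≐ λ e → trans (x+x≈x⇒x≈0 _ (trans (sym (coef-⊞ (ψ 𝟘) (ψ 𝟘) e))
      (trans (sym (at (add 𝟘 𝟘) e)) (at (cong (⊞-identityʳ 𝟘)) e)))) (sym (coef-𝟘 e))
  open IsLinear public

  -- `C` selects total degrees. With `_< r` this is vanishing to order r at the origin, with `d <_`
  -- it is degree at most d, and with the constant `⊤` it is being zero, so one set of closure
  -- lemmas serves all three. Using coefficients rather than derivatives makes it work in every
  -- characteristic.
  record Vanishes {n} (C : ℕ → Set) (f : Poly n) : Set ℓ where
    constructor vanishing
    field on : ∀ e → C (Vec.sum e) → coef f e ≈ 0#
  open Vanishes public

  all⇒≐𝟘 : ∀ {n} {f : Poly n} → Vanishes (λ _ → ⊤) f → f ≐ 𝟘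
  all⇒≐𝟘 v = mk≐ λ e → trans (on v e tt) (sym (coef-𝟘 e))

  ≐𝟘⇒vanishes : ∀ {n C} {f : Poly n} → f ≐ 𝟘 → Vanishes C f
  ≐𝟘⇒vanishes p = vanishing λ e _ → trans (at p e) (coef-𝟘 e)

  vanishes-cong : ∀ {n C} {f g : Poly n} → f ≐ g → Vanishes C f → Vanishes C g
  vanishes-cong p v = vanishing λ e c → trans (sym (at p e)) (on v e c)

  vanishes-weaken : ∀ {n} {C D : ℕ → Set} {f : Poly n} → (∀ k → D k → C k) → Vanishes C f → Vanishes D f
  vanishes-weaken w v = vanishing λ e d → on v e (w _ d)

  vanishes-⊞ : ∀ {n C} (f g : Poly n) → Vanishes C f → Vanishes C g → Vanishes C (f ⊞ g)
  vanishes-⊞ f g v w = vanishing λ e c →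
    trans (coef-⊞ f g e) (trans (+-cong (on v e c) (on w e c)) (+-identityˡ _))

  vanishes-• : ∀ {n C} c (f : Poly n) → Vanishes C f → Vanishes C (c • f)
  vanishes-• c f v = vanishing λ e p → trans (coef-• c f e) (trans (*-congˡ (on v e p)) (zeroʳ c))

  vanishes-head : ∀ {n C} {f : Poly n} {f′} → Vanishes C (cons f f′) → Vanishes C f
  vanishes-head v = vanishing λ e → on v (zero ∷ e)

  vanishes-tail : ∀ {n C} {f : Poly n} {f′} → Vanishes C (cons f f′) → Vanishes (C ∘ suc) f′
  vanishes-tail v = vanishing λ { (k ∷ e) → on v (suc k ∷ e) }

  vanishes-cons : ∀ {n C} {f : Poly n} {f′} → Vanishes C f → Vanishes (C ∘ suc) f′ → Vanishes C (cons f f′)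
  vanishes-cons v w = vanishing λ { (zero ∷ e) → on v e ; (suc k ∷ e) → on w (k ∷ e) }

  vanishes-X : ∀ {n C} (i : Fin n) (f : Poly n) → Vanishes (C ∘ suc) f → Vanishes C (X i f)
  vanishes-X zero    f           v = vanishes-cons (≐𝟘⇒vanishes ≐-refl) v
  vanishes-X (suc i) nil         v = ≐𝟘⇒vanishes ≐-refl
  vanishes-X (suc i) (cons f f′) v =
    vanishes-cons (vanishes-X i f (vanishes-head v)) (vanishes-X (suc i) f′ (vanishes-tail v))

  X-linear : ∀ {n} (i : Fin n) → IsLinear (X i)
  X-linear i = record { cong = X-cong i ; add = X-add i ; scal = X-scal i }
    where
    tail≐ : ∀ {n} {f g : Poly n} {f′ g′} → cons f f′ ≐ cons g g′ → f′ ≐ g′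
    tail≐ p = mk≐ λ { (k ∷ e) → at p (suc k ∷ e) }
    head≐ : ∀ {n} {f g : Poly n} {f′ g′} → cons f f′ ≐ cons g g′ → f ≐ g
    head≐ p = mk≐ λ e → at p (zero ∷ e)
    X-zero : ∀ {n} (i : Fin n) {f} → f ≐ 𝟘 → X i f ≐ 𝟘
    X-zero i p = all⇒≐𝟘 (vanishes-X i _ (≐𝟘⇒vanishes p))
    X-cong : ∀ {n} (i : Fin n) {f g} → f ≐ g → X i f ≐ X i g
    X-cong zero    p = cons-cong ≐-refl p
    X-cong (suc i) {nil}       {g}         p = ≐-sym (X-zero (suc i) (≐-sym p))
    X-cong (suc i) {cons f f′} {nil}       p = X-zero (suc i) p
    X-cong (suc i) {cons f f′} {cons g g′} p = cons-cong (X-cong i (head≐ p)) (X-cong (suc i) (tail≐ p))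
    X-add : ∀ {n} (i : Fin n) f g → X i (f ⊞ g) ≐ X i f ⊞ X i g
    X-add zero    f           g           = cons-cong (≐-sym (⊞-identityʳ 𝟘)) ≐-refl
    X-add (suc i) nil         g           = ≐-refl
    X-add (suc i) (cons f f′) nil         = ≐-refl
    X-add (suc i) (cons f f′) (cons g g′) = cons-cong (X-add i f g) (X-add (suc i) f′ g′)
    X-scal : ∀ {n} (i : Fin n) c f → X i (c • f) ≐ c • X i f
    X-scal zero    c f           = cons-cong (≐-sym (•-zeroʳ c)) ≐-refl
    X-scal (suc i) c nil         = ≐-refl
    X-scal (suc i) c (cons f f′) = cons-cong (X-scal i c f) (X-scal (suc i) c f′)

  X-comm : ∀ {n} (i j : Fin n) f → X i (X j f) ≐ X j (X i f)
  X-comm zero    zero    f           = ≐-refl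
  X-comm zero    (suc j) f           = cons-cong (≐-sym (null (X-linear j))) ≐-refl
  X-comm (suc i) zero    f           = cons-cong (null (X-linear i)) ≐-refl
  X-comm (suc i) (suc j) nil         = ≐-refl
  X-comm (suc i) (suc j) (cons f f′) = cons-cong (X-comm i j f) (X-comm (suc i) (suc j) f′)

  -- Substitution of commuting linear operators for the variables: Poly n is the free module over F[X] on 𝟙.
  hom : ∀ {n m} → (Fin n → Poly m → Poly m) → Poly n → Poly m
  hom T (con c)     = c • 𝟙
  hom T nil         = 𝟘
  hom T (cons f f′) = hom (T ∘ suc) f ⊞ T zero (hom T f′)

  𝟙-vanishes : ∀ {m} {C : ℕ → Set} {c} → (C 0 → c ≈ 0#) → Vanishes C (c • 𝟙 {m})
  𝟙-vanishes {zero}  p = vanishing λ { [] x → trans (*-congʳ (p x)) (zeroˡ 1#) }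
  𝟙-vanishes {suc m} p = vanishes-cons (𝟙-vanishes p) (≐𝟘⇒vanishes ≐-refl)

  -- The tail of a `cons` is controlled in degrees shifted by one, and `T zero` undoes the shift.
  -- The class `𝒞`, closed under this shift, carries whatever `T` requires of the predicates:
  -- nothing, upward closure, or being true everywhere.
  hom-vanishes : ∀ {m} (𝒞 : (ℕ → Set) → Set) → (∀ {C} → 𝒞 C → 𝒞 (C ∘ suc)) →
    ∀ {n} (T : Fin n → Poly m → Poly m) →
    (∀ i {C} → 𝒞 C → ∀ f → Vanishes (C ∘ suc) f → Vanishes C (T i f)) →
    ∀ {C} → 𝒞 C → (f : Poly n) → Vanishes C f → Vanishes C (hom T f)
  hom-vanishes 𝒞 cl T ok c (con x) v = 𝟙-vanishes (on v [])
  hom-vanishes 𝒞 cl T ok c nil v = ≐𝟘⇒vanishes ≐-refl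
  hom-vanishes 𝒞 cl T ok c (cons f f′) v = vanishes-⊞ (hom (T ∘ suc) f) (T zero (hom T f′))
    (hom-vanishes 𝒞 cl (T ∘ suc) (ok ∘ suc) c f (vanishes-head v))
    (ok zero c _ (hom-vanishes 𝒞 cl T ok (cl c) f′ (vanishes-tail v)))

  ≐-from-difference : ∀ {n} {f g : Poly n} → f ⊞ (- 1#) • g ≐ 𝟘 → f ≐ g
  ≐-from-difference {f = f} {g} p = mk≐ λ e →
    trans (inverseˡ-unique _ _ (trans (sym (coef-⊞ f ((- 1#) • g) e)) (trans (at p e) (coef-𝟘 e))))
     (trans (-‿cong (trans (coef-• _ g e) (-1*x≈-x _))) (-‿involutive _))

  difference-𝟘 : ∀ {n} {f g : Poly n} → f ≐ g → f ⊞ (- 1#) • g ≐ 𝟘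
  difference-𝟘 {f = f} {g} p = mk≐ λ e → trans (coef-⊞ f ((- 1#) • g) e)
    (trans (+-cong (at p e) (trans (coef-• _ g e) (-1*x≈-x _)))
     (trans (-‿inverseʳ _) (sym (coef-𝟘 e))))

  -- `hom T` recurses on representations, of which 0 has many. Hence additivity and homogeneity come
  -- first; compatibility with `≐` is then checked only at 0 and transferred to differences.
  hom-linear : ∀ {n m} (T : Fin n → Poly m → Poly m) → (∀ i → IsLinear (T i)) → IsLinear (hom T)
  hom-linear {m = m} T lin = record { cong = hom-cong ; add = hom-add T lin ; scal = hom-scal T lin }
    where
    hom-add : ∀ {n} (T : Fin n → Poly m → Poly m) → (∀ i → IsLinear (T i)) → ∀ f g → hom T (f ⊞ g) ≐ hom T f ⊞ hom T g
    hom-add T lin (con c) (con d) = •-distribʳ c d 𝟙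
    hom-add T lin nil g = ≐-sym (⊞-identityˡ _)
    hom-add T lin (cons f f′) nil = ≐-sym (⊞-identityʳ _)
    hom-add T lin (cons f f′) (cons g g′) = ≐-trans
      (⊞-cong (hom-add (T ∘ suc) (lin ∘ suc) f g)
        (≐-trans (cong (lin zero) (hom-add T lin f′ g′)) (add (lin zero) (hom T f′) (hom T g′))))
      (⊞-interchange (hom (T ∘ suc) f) _ _ _)
    hom-scal : ∀ {n} (T : Fin n → Poly m → Poly m) → (∀ i → IsLinear (T i)) → ∀ c f → hom T (c • f) ≐ c • hom T f
    hom-scal T lin c (con d) = •-assoc c d 𝟙
    hom-scal T lin c nil = ≐-sym (•-zeroʳ c)
    hom-scal T lin c (cons f f′) = ≐-trans
      (⊞-cong (hom-scal (T ∘ suc) (lin ∘ suc) c f)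
        (≐-trans (cong (lin zero) (hom-scal T lin c f′)) (scal (lin zero) _ _)))
      (≐-sym (•-distribˡ c (hom (T ∘ suc) f) _))
    hom-zero : ∀ {f} → f ≐ 𝟘 → hom T f ≐ 𝟘
    hom-zero p = all⇒≐𝟘 (hom-vanishes (λ C → ∀ k → C k) (_∘ suc) T
      (λ i c f v → ≐𝟘⇒vanishes (≐-trans (cong (lin i) (mk≐ λ e → trans (on v e (c _)) (sym (coef-𝟘 e)))) (null (lin i))))
      (λ _ → tt) _ (≐𝟘⇒vanishes p))
    hom-cong : ∀ {f g} → f ≐ g → hom T f ≐ hom T g
    hom-cong {f} {g} p = ≐-from-difference (≐-trans
      (≐-sym (≐-trans (hom-add T lin f ((- 1#) • g)) (⊞-cong (≐-refl {x = hom T f}) (hom-scal T lin (- 1#) g))))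
      (hom-zero (difference-𝟘 p)))

  -- In the tail of a `cons`, `X (suc i)` sits inside `T zero`; commutativity moves `T (suc i)` out.
  hom-X : ∀ {n m} (T : Fin n → Poly m → Poly m) → (∀ i → IsLinear (T i)) →
    (∀ i j f → T i (T j f) ≐ T j (T i f)) → ∀ i f → hom T (X i f) ≐ T i (hom T f)
  hom-X T lin comm zero f = ≐-trans (⊞-cong (null (hom-linear (T ∘ suc) (lin ∘ suc))) ≐-refl) (⊞-identityˡ _)
  hom-X T lin comm (suc i) nil = ≐-sym (null (lin (suc i)))
  hom-X T lin comm (suc i) (cons f f′) = ≐-trans
    (⊞-cong (hom-X (T ∘ suc) (lin ∘ suc) (λ i j → comm (suc i) (suc j)) i f)
      (≐-trans (cong (lin zero) (hom-X T lin comm (suc i) f′)) (comm zero (suc i) _)))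
    (≐-sym (add (lin (suc i)) _ _))

  hom-𝟙 : ∀ {n m} (T : Fin n → Poly m → Poly m) → (∀ i → IsLinear (T i)) → hom T 𝟙 ≐ 𝟙
  hom-𝟙 {zero} T lin = mk≐ λ e → trans (coef-• 1# 𝟙 e) (*-identityˡ _)
  hom-𝟙 {suc n} T lin = ≐-trans (⊞-cong (hom-𝟙 (T ∘ suc) (lin ∘ suc)) (null (lin zero))) (⊞-identityʳ _)

  -- `𝟙` generates all polynomials under linear combinations and the `X i`. The head of a `cons` is
  -- handled by restricting `ψ` to polynomials without x₀.
  hom-unique : ∀ {n m} (T : Fin n → Poly m → Poly m) → (∀ i → IsLinear (T i)) →
    (ψ : Poly n → Poly m) → IsLinear ψ → ψ 𝟙 ≐ 𝟙 → (∀ i f → ψ (X i f) ≐ T i (ψ f)) →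
    ∀ f → ψ f ≐ hom T f
  hom-unique T lin ψ ψ-lin ψ-𝟙 ψ-X (con c) = ≐-trans (cong ψ-lin (mk≐ λ { [] → sym (*-identityʳ c) }))
    (≐-trans (scal ψ-lin c 𝟙) (•-cong refl ψ-𝟙))
  hom-unique T lin ψ ψ-lin ψ-𝟙 ψ-X nil = null ψ-lin
  hom-unique T lin ψ ψ-lin ψ-𝟙 ψ-X (cons f f′) = ≐-trans (cong ψ-lin split) (≐-trans (add ψ-lin _ _)
    (⊞-cong (hom-unique (T ∘ suc) (lin ∘ suc) (λ h → ψ (cons h nil))
        (record { cong = λ p → cong ψ-lin (cons-cong p ≐-refl)
                ; add = λ f g → add ψ-lin _ _
                ; scal = λ c f → scal ψ-lin _ _ })
        ψ-𝟙 (λ i h → ψ-X (suc i) (cons h nil)) f)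
      (≐-trans (ψ-X zero f′) (cong (lin zero) (hom-unique T lin ψ ψ-lin ψ-𝟙 ψ-X f′)))))
    where
    split : cons f f′ ≐ cons f nil ⊞ X zero f′
    split = cons-cong (≐-sym (⊞-identityʳ f)) ≐-refl

module Substitutions {a ℓ : Level} (F : Field a ℓ) where
  open Field F hiding (zero)
  open Polynomials F
  open import Algebra.Properties.Semiring.Sum semiring
    using (∑-distrib-+; ∑-comm; *-distribˡ-sum; *-distribʳ-sum)
    renaming (sum to ∑; sum-cong-≋ to ∑-cong)

  id-linear : ∀ {n} → IsLinear (id {A = Poly n})
  id-linear = record { cong = id ; add = λ _ _ → ≐-refl ; scal = λ _ _ → ≐-refl }

  ∘-linear : ∀ {k m n} {ψ : Poly m → Poly n} {φ : Poly k → Poly m} →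
    IsLinear ψ → IsLinear φ → IsLinear (ψ ∘ φ)
  ∘-linear p q = record
    { cong = cong p ∘ cong q
    ; add  = λ f g → ≐-trans (cong p (add q f g)) (add p _ _)
    ; scal = λ c f → ≐-trans (cong p (scal q c f)) (scal p c _)
    }

  ⊞-linear : ∀ {m n} {φ ψ : Poly m → Poly n} → IsLinear φ → IsLinear ψ → IsLinear (λ f → φ f ⊞ ψ f)
  ⊞-linear {φ = φ} {ψ} p q = record
    { cong = λ r → ⊞-cong (cong p r) (cong q r)
    ; add  = λ f g → ≐-trans (⊞-cong (add p f g) (add q f g)) (⊞-interchange (φ f) _ _ _)
    ; scal = λ c f → ≐-trans (⊞-cong (scal p c f) (scal q c f)) (≐-sym (•-distribˡ c (φ f) _))
    }

  •-linear : ∀ {m n} c {ψ : Poly m → Poly n} → IsLinear ψ → IsLinear (λ f → c • ψ f)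
  •-linear c {ψ} p = record
    { cong = λ r → •-cong refl (cong p r)
    ; add  = λ f g → ≐-trans (•-cong refl (add p f g)) (•-distribˡ c (ψ f) _)
    ; scal = λ d f → ≐-trans (•-cong refl (scal p d f)) (•-comm c d (ψ f))
    }

  comb : ∀ {k m} → (Fin k → Carrier) → (Fin k → Poly m) → Poly m
  comb {zero}  α v = 𝟘
  comb {suc k} α v = α zero • v zero ⊞ comb (α ∘ suc) (v ∘ suc)

  coef-comb : ∀ {k m} (α : Fin k → Carrier) (v : Fin k → Poly m) e →
    coef (comb α v) e ≈ ∑ (λ i → α i * coef (v i) e)
  coef-comb {zero}  α v e = coef-𝟘 e
  coef-comb {suc k} α v e = trans (coef-⊞ (α zero • v zero) _ e)
    (+-cong (coef-• (α zero) (v zero) e) (coef-comb (α ∘ suc) (v ∘ suc) e))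

  comb-cong : ∀ {k m} (α : Fin k → Carrier) {v w : Fin k → Poly m} → (∀ i → v i ≐ w i) → comb α v ≐ comb α w
  comb-cong {zero}  α p = ≐-refl
  comb-cong {suc k} α p = ⊞-cong (•-cong refl (p zero)) (comb-cong (α ∘ suc) (p ∘ suc))

  comb-linear : ∀ {k m n} (α : Fin k → Carrier) {S : Fin k → Poly m → Poly n} → (∀ i → IsLinear (S i)) →
    IsLinear (λ f → comb α (λ i → S i f))
  comb-linear {zero}  α p = record
    { cong = λ _ → ≐-refl ; add = λ f g → ≐-sym (⊞-identityʳ 𝟘) ; scal = λ c f → ≐-sym (•-zeroʳ c) }
  comb-linear {suc k} α p = ⊞-linear (•-linear (α zero) (p zero)) (comb-linear (α ∘ suc) (p ∘ suc))

  linear-comb : ∀ {k m n} {ψ : Poly m → Poly n} → IsLinear ψ → (α : Fin k → Carrier) (v : Fin k → Poly m) →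
    ψ (comb α v) ≐ comb α (ψ ∘ v)
  linear-comb {zero}  p α v = null p
  linear-comb {suc k} p α v = ≐-trans (add p _ _) (⊞-cong (scal p _ _) (linear-comb p (α ∘ suc) (v ∘ suc)))

  vanishes-comb : ∀ {k m C} (α : Fin k → Carrier) (v : Fin k → Poly m) →
    (∀ i → Vanishes C (v i)) → Vanishes C (comb α v)
  vanishes-comb {zero}  α v p = ≐𝟘⇒vanishes ≐-refl
  vanishes-comb {suc k} α v p = vanishes-⊞ (α zero • v zero) _ (vanishes-• _ _ (p zero))
    (vanishes-comb (α ∘ suc) (v ∘ suc) (p ∘ suc))

  -- The substitution xᵢ ↦ offset i + Σₖ matrix i k · xₖ.
  record Affine (n m : ℕ) : Set a where
    constructor affine
    field
      offset : Fin n → Carrier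
      matrix : Fin n → Fin m → Carrier
  open Affine public

  -- Multiplication by the affine form that is substituted for the `i`-th variable.
  affOp : ∀ {n m} → Affine n m → Fin n → Poly m → Poly m
  affOp A i f = offset A i • f ⊞ comb (matrix A i) (λ k → X k f)

  affOp-linear : ∀ {n m} (A : Affine n m) i → IsLinear (affOp A i)
  affOp-linear A i = ⊞-linear (•-linear (offset A i) id-linear) (comb-linear (matrix A i) X-linear)

  coef-affOp : ∀ {n m} (A : Affine n m) i f e →
    coef (affOp A i f) e ≈ offset A i * coef f e + ∑ (λ k → matrix A i k * coef (X k f) e)
  coef-affOp A i f e = trans (coef-⊞ (offset A i • f) _ e)
    (+-cong (coef-• (offset A i) f e) (coef-comb (matrix A i) _ e))

  linear-affOp : ∀ {n m l} {ψ : Poly m → Poly l} → IsLinear ψ → (A : Affine n m) → ∀ i f →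
    ψ (affOp A i f) ≐ offset A i • ψ f ⊞ comb (matrix A i) (λ k → ψ (X k f))
  linear-affOp p A i f = ≐-trans (add p _ _) (⊞-cong (scal p _ _) (linear-comb p (matrix A i) _))

  affOp-commutes : ∀ {n m} {ψ : Poly m → Poly m} → IsLinear ψ → (∀ k f → ψ (X k f) ≐ X k (ψ f)) →
    (A : Affine n m) → ∀ i f → ψ (affOp A i f) ≐ affOp A i (ψ f)
  affOp-commutes p q A i f = ≐-trans (linear-affOp p A i f)
    (⊞-cong ≐-refl (comb-cong (matrix A i) (λ k → q k f)))

  -- `affOp-commutes` is used twice: each `X k` commutes with all variables, hence with `affOp A i`,
  -- which therefore qualifies as `ψ`.
  affOp-comm : ∀ {n m} (A : Affine n m) i j f → affOp A i (affOp A j f) ≐ affOp A j (affOp A i f)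
  affOp-comm A i j f = affOp-commutes (affOp-linear A i)
    (λ k g → ≐-sym (affOp-commutes (X-linear k) (X-comm k) A i g)) A j f

  subst : ∀ {n m} → Affine n m → Poly n → Poly m
  subst A = hom (affOp A)

  -- These properties determine `ψ` up to `≐`, so two composites of substitutions agree once both
  -- have them for the same `A`; nothing needs to be expanded.
  record IsSubst {n m} (A : Affine n m) (ψ : Poly n → Poly m) : Set (a ⊔ ℓ) where
    field
      linear : IsLinear ψ
      unit   : ψ 𝟙 ≐ 𝟙
      var    : ∀ i f → ψ (X i f) ≐ affOp A i (ψ f)
  open IsSubst public

  isSubst : ∀ {n m} (A : Affine n m) → IsSubst A (subst A)
  isSubst A = record
    { linear = hom-linear (affOp A) (affOp-linear A)
    ; unit   = hom-𝟙 (affOp A) (affOp-linear A)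
    ; var    = hom-X (affOp A) (affOp-linear A) (affOp-comm A)
    }

  subst-linear : ∀ {n m} (A : Affine n m) → IsLinear (subst A)
  subst-linear A = linear (isSubst A)

  subst-unique : ∀ {n m} {A : Affine n m} {ψ} → IsSubst A ψ → ∀ f → ψ f ≐ subst A f
  subst-unique {A = A} {ψ} p = hom-unique (affOp A) (affOp-linear A) ψ (linear p) (unit p) (var p)

  infix 4 _≃_
  record _≃_ {n m} (A B : Affine n m) : Set ℓ where
    field
      offset≈ : ∀ i → offset A i ≈ offset B i
      matrix≈ : ∀ i k → matrix A i k ≈ matrix B i k
  open _≃_ public

  isSubst-resp : ∀ {n m} {A B : Affine n m} {ψ} → A ≃ B → IsSubst A ψ → IsSubst B ψ
  isSubst-resp {A = A} {B} {ψ} p q = record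
    { linear = linear q
    ; unit = unit q
    ; var = λ i f → ≐-trans (var q i f) (mk≐ λ e → trans (coef-affOp A i (ψ f) e)
        (trans (+-cong (*-congʳ (offset≈ p i)) (∑-cong (λ k → *-congʳ (matrix≈ p i k))))
          (sym (coef-affOp B i (ψ f) e))))
    }

  infixl 6 _⨟_
  -- The forms of `B` are inserted into those of `A`, so `subst A` is applied first and `subst B`
  -- after it.
  _⨟_ : ∀ {n m l} → Affine n m → Affine m l → Affine n l
  A ⨟ B = affine (λ i → offset A i + ∑ (λ k → matrix A i k * offset B k))
                 (λ i j → ∑ (λ k → matrix A i k * matrix B k j))

  ∑-*-assoc : ∀ {n} (u v : Fin n → Carrier) x → ∑ (λ k → u k * (v k * x)) ≈ ∑ (λ k → u k * v k) * x
  ∑-*-assoc u v x = trans (∑-cong {x = λ k → u k * (v k * x)} (λ k → sym (*-assoc (u k) (v k) x)))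
    (sym (*-distribʳ-sum x (λ k → u k * v k)))

  affOp-⨟ : ∀ {n m l} (A : Affine n m) (B : Affine m l) i f →
    offset A i • f ⊞ comb (matrix A i) (λ k → affOp B k f) ≐ affOp (A ⨟ B) i f
  affOp-⨟ A B i f = mk≐ λ e → let x = coef f e ; y = λ j → coef (X j f) e ; M = matrix A i in begin
    coef (offset A i • f ⊞ comb M (λ k → affOp B k f)) e
      ≈⟨ coef-⊞ (offset A i • f) _ e ⟩
    coef (offset A i • f) e + coef (comb M (λ k → affOp B k f)) e
      ≈⟨ +-cong (coef-• (offset A i) f e) (coef-comb M _ e) ⟩
    offset A i * x + ∑ (λ k → M k * coef (affOp B k f) e)
      ≈⟨ +-congˡ (∑-cong (λ k → trans (*-congˡ (coef-affOp B k f e)) (distribˡ (M k) _ _))) ⟩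
    offset A i * x + ∑ (λ k → M k * (offset B k * x) + M k * ∑ (λ j → matrix B k j * y j))
      ≈⟨ +-congˡ (∑-distrib-+ (λ k → M k * (offset B k * x)) (λ k → M k * ∑ (λ j → matrix B k j * y j))) ⟩
    offset A i * x + (∑ (λ k → M k * (offset B k * x)) + ∑ (λ k → M k * ∑ (λ j → matrix B k j * y j)))
      ≈⟨ +-assoc _ _ _ ⟨
    offset A i * x + ∑ (λ k → M k * (offset B k * x)) + ∑ (λ k → M k * ∑ (λ j → matrix B k j * y j))
      ≈⟨ +-cong (+-congˡ (∑-*-assoc M (offset B) x))
                (trans (∑-cong (λ k → *-distribˡ-sum (M k) (λ j → matrix B k j * y j)))
                  (∑-comm (λ k j → M k * (matrix B k j * y j)))) ⟩
    offset A i * x + ∑ (λ k → M k * offset B k) * x + ∑ (λ j → ∑ (λ k → M k * (matrix B k j * y j)))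
      ≈⟨ +-cong (sym (distribʳ x (offset A i) _)) (∑-cong (λ j → ∑-*-assoc M (λ k → matrix B k j) (y j))) ⟩
    offset (A ⨟ B) i * x + ∑ (λ j → matrix (A ⨟ B) i j * y j)
      ≈⟨ coef-affOp (A ⨟ B) i f e ⟨
    coef (affOp (A ⨟ B) i f) e ∎
    where open import Relation.Binary.Reasoning.Setoid setoid

  isSubst-∘ : ∀ {n m l} {A : Affine n m} {B : Affine m l} {φ ψ} →
    IsSubst A φ → IsSubst B ψ → IsSubst (A ⨟ B) (ψ ∘ φ)
  isSubst-∘ {A = A} {B} {φ} {ψ} p q = record
    { linear = ∘-linear (linear q) (linear p)
    ; unit = ≐-trans (cong (linear q) (unit p)) (unit q)
    ; var = λ i f → ≐-trans (cong (linear q) (var p i f)) (≐-trans (linear-affOp (linear q) A i (φ f))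
        (≐-trans (⊞-cong ≐-refl (comb-cong (matrix A i) (λ k → var q k (φ f)))) (affOp-⨟ A B i (ψ (φ f)))))
    }

  subst-⨟ : ∀ {n m l} {A : Affine n m} {B : Affine m l} {C : Affine n l} → A ⨟ B ≃ C → ∀ f →
    subst B (subst A f) ≐ subst C f
  subst-⨟ {A = A} {B} p = subst-unique (isSubst-resp p (isSubst-∘ (isSubst A) (isSubst B)))

  -- Without constant terms every variable goes to a homogeneous linear form, so homogeneous
  -- components keep their degree and any `C` is allowed.
  subst-vanishes : ∀ {n m} (A : Affine n m) → (∀ i → offset A i ≈ 0#) → ∀ {C} f →
    Vanishes C f → Vanishes C (subst A f)
  subst-vanishes A p = hom-vanishes (λ _ → ⊤) _ (affOp A)
    (λ i _ f v → vanishes-⊞ (offset A i • f) _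
      (vanishing λ e _ → trans (coef-• _ f e) (trans (*-congʳ (p i)) (zeroˡ _)))
      (vanishes-comb _ _ (λ k → vanishes-X k f v))) tt

  -- Applied to C = (d <_): affine substitutions do not raise the degree.
  subst-degree : ∀ {n m} (A : Affine n m) {C} → (∀ k → C k → C (suc k)) → ∀ f →
    Vanishes C f → Vanishes C (subst A f)
  subst-degree A up = hom-vanishes (λ C → ∀ k → C k → C (suc k)) (_∘ suc) (affOp A)
    (λ i c f v → vanishes-⊞ (offset A i • f) _
      (vanishes-• _ f (vanishing λ e x → on v e (c _ x)))
      (vanishes-comb _ _ (λ k → vanishes-X k f v))) up

  δ : ∀ {n} → Fin n → Fin n → Carrier
  δ zero    zero    = 1#
  δ zero    (suc j) = 0#
  δ (suc i) zero    = 0#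
  δ (suc i) (suc j) = δ i j

  ∑-zero : ∀ {n} {u : Fin n → Carrier} → (∀ i → u i ≈ 0#) → ∑ u ≈ 0#
  ∑-zero {zero}  p = refl
  ∑-zero {suc n} p = trans (+-cong (p zero) (∑-zero (p ∘ suc))) (+-identityˡ _)

  ∑-δ : ∀ {n} (i : Fin n) (u : Fin n → Carrier) → ∑ (λ k → δ i k * u k) ≈ u i
  ∑-δ zero    u = trans (+-cong (*-identityˡ _) (∑-zero (λ k → zeroˡ (u (suc k))))) (+-identityʳ _)
  ∑-δ (suc i) u = trans (+-cong (zeroˡ _) (∑-δ i (u ∘ suc))) (+-identityˡ _)

  ∑-δʳ : ∀ {n} (i : Fin n) (u : Fin n → Carrier) → ∑ (λ k → u k * δ k i) ≈ u i
  ∑-δʳ zero    u = trans (+-cong (*-identityʳ _) (∑-zero (λ k → zeroʳ (u (suc k))))) (+-identityʳ _)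
  ∑-δʳ (suc i) u = trans (+-cong (zeroʳ _) (∑-δʳ i (u ∘ suc))) (+-identityˡ _)

  -- Translations along a coordinate, and slices.

  translation : ∀ {n} → (Fin n → Carrier) → Affine n n
  translation q = affine q δ

  affOp-translation : ∀ {n} (q : Fin n → Carrier) k f → affOp (translation q) k f ≐ X k f ⊞ q k • f
  affOp-translation q k f = mk≐ λ e → trans (coef-affOp (translation q) k f e)
    (trans (+-comm _ _) (sym (trans (coef-⊞ (X k f) _ e)
      (+-cong (sym (∑-δ k (λ l → coef (X l f) e))) (coef-• (q k) f e)))))

  id-isSubst : ∀ {n} {q : Fin n → Carrier} → (∀ i → q i ≈ 0#) → IsSubst (translation q) id
  id-isSubst {q = q} p = record
    { linear = id-linear
    ; unit = ≐-refl
    ; var = λ i f → ≐-sym (≐-trans (affOp-translation q i f) (≐-trans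
        (⊞-congˡ (X i f) (•-zeroˡ f (p i)))
        (⊞-identityʳ (X i f))))
    }

  shift : ∀ {n} → Fin n → Carrier → Poly n → Poly n
  shift i t = subst (translation (λ k → t * δ i k))

  shift-linear : ∀ {n} (i : Fin n) t → IsLinear (shift i t)
  shift-linear i t = subst-linear _

  shift-X : ∀ {n} (i : Fin n) t k f → shift i t (X k f) ≐ X k (shift i t f) ⊞ (t * δ i k) • shift i t f
  shift-X i t k f = ≐-trans (var (isSubst (translation λ l → t * δ i l)) k f) (affOp-translation (λ l → t * δ i l) k (shift i t f))

  constant-isLinear : ∀ {n} → IsLinear (λ (f : Poly n) → cons f nil)
  constant-isLinear = record
    { cong = λ p → cons-cong p ≐-refl ; add = λ _ _ → ≐-refl ; scal = λ _ _ → ≐-refl }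

  constant-affOp : ∀ {n} (q : Fin (suc n) → Carrier) k f →
    cons (affOp (translation (q ∘ suc)) k f) nil ≐ affOp (translation q) (suc k) (cons f nil)
  constant-affOp q k f = ≐-trans (cons-cong (affOp-translation (q ∘ suc) k f) ≐-refl)
    (≐-sym (affOp-translation q (suc k) (cons f nil)))

  -- The head of a `cons` does not involve x₀, and neither does its translate; uniqueness of `hom`
  -- shows that the translate can be computed in the remaining variables.
  subst-constant : ∀ {n} (q : Fin (suc n) → Carrier) f →
    hom (affOp (translation q) ∘ suc) f ≐ cons (subst (translation (q ∘ suc)) f) nil
  subst-constant q f = ≐-sym (hom-unique (affOp (translation q) ∘ suc) (affOp-linear (translation q) ∘ suc)
    (λ g → cons (subst (translation (q ∘ suc)) g) nil)
    (∘-linear constant-isLinear (subst-linear _))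
    (cons-cong (unit (isSubst (translation (q ∘ suc)))) ≐-refl)
    (λ i g → ≐-trans (cons-cong (var (isSubst _) i g) ≐-refl) (constant-affOp q i _)) f)

  shift-cons-zero : ∀ {n} t (f : Poly n) g →
    shift zero t (cons f g) ≐ cons f nil ⊞ (X zero (shift zero t g) ⊞ t • shift zero t g)
  shift-cons-zero t f g = ⊞-cong
    (≐-trans (subst-constant (λ k → t * δ zero k) f)
      (cons-cong (≐-sym (subst-unique (id-isSubst {q = λ _ → t * 0#} (λ _ → zeroʳ t)) f)) ≐-refl))
    (≐-trans (affOp-translation (λ k → t * δ zero k) zero (shift zero t g)) (⊞-congˡ (X zero (shift zero t g)) (•-cong (*-identityʳ t) (≐-refl {x = shift zero t g}))))

  shift-cons-suc : ∀ {n} (i : Fin n) t f g →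
    shift (suc i) t (cons f g) ≐ cons (shift i t f) (shift (suc i) t g)
  shift-cons-suc i t f g = ≐-trans (⊞-cong (subst-constant (λ k → t * δ (suc i) k) f)
      (≐-trans (affOp-translation (λ k → t * δ (suc i) k) zero (shift (suc i) t g))
        (≐-trans (⊞-congˡ (X zero (shift (suc i) t g)) (•-zeroˡ (shift (suc i) t g) (zeroʳ t)))
          (⊞-identityʳ (X zero (shift (suc i) t g))))))
    (cons-cong (⊞-identityʳ _) ≐-refl)

  -- The polynomial in variable `i` that multiplies the monomial with exponents `e` in the other
  -- variables. With `e` = 0 it is the restriction to the coordinate axis; other `e` play the part
  -- of transversal derivatives.
  slice : ∀ {n} → Fin (suc n) → Vec ℕ n → Poly (suc n) → Poly 1
  slice zero    e           nil        = nil
  slice zero    e           (cons f g) = cons (con (coef f e)) (slice zero e g)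
  slice (suc i) (k ∷ e)     nil        = nil
  slice (suc i) (zero ∷ e)  (cons f g) = slice i e f
  slice (suc i) (suc k ∷ e) (cons f g) = slice (suc i) (k ∷ e) g

  coef-slice : ∀ {n} (i : Fin (suc n)) (e : Vec ℕ n) f k →
    coef (slice i e f) (k ∷ []) ≈ coef f (insertAt e i k)
  coef-slice zero    e           nil        k       = refl
  coef-slice zero    e           (cons f g) zero    = refl
  coef-slice zero    e           (cons f g) (suc k) = coef-slice zero e g k
  coef-slice (suc i) (x ∷ e)     nil        k       = refl
  coef-slice (suc i) (zero ∷ e)  (cons f g) k       = coef-slice i e f k
  coef-slice (suc i) (suc x ∷ e) (cons f g) k       = coef-slice (suc i) (x ∷ e) g k

  slice-linear : ∀ {n} (i : Fin (suc n)) (e : Vec ℕ n) → IsLinear (slice i e)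
  slice-linear i e = record
    { cong = λ {f} {g} p → mk≐ λ { (k ∷ []) →
        trans (coef-slice i e f k) (trans (at p _) (sym (coef-slice i e g k))) }
    ; add = λ f g → mk≐ λ { (k ∷ []) → trans (coef-slice i e (f ⊞ g) k) (trans (coef-⊞ f g _)
        (sym (trans (coef-⊞ (slice i e f) _ _) (+-cong (coef-slice i e f k) (coef-slice i e g k))))) }
    ; scal = λ c f → mk≐ λ { (k ∷ []) → trans (coef-slice i e (c • f) k) (trans (coef-• c f _)
        (sym (trans (coef-• c (slice i e f) _) (*-congˡ (coef-slice i e f k))))) }
    }

  -- A translation of variable `i` does not touch the others, so it acts on each coefficient with
  -- respect to them separately.
  slice-shift : ∀ {n} (i : Fin (suc n)) (e : Vec ℕ n) t f →
    slice i e (shift i t f) ≐ shift zero t (slice i e f)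
  slice-shift zero e t nil = ≐-refl
  slice-shift zero e t (cons f g) = ≐-trans (cong L (shift-cons-zero t f g))
    (≐-trans (add L (cons f nil) (X zero h ⊞ t • h))
      (≐-trans (⊞-congˡ (cons (con (coef f e)) nil) (≐-trans (add L (X zero h) (t • h))
          (⊞-cong (cons-cong {f = con (coef 𝟘 e)} (mk≐ λ { [] → coef-𝟘 e }) (slice-shift zero e t g))
            (≐-trans (scal L t h) (•-cong refl (slice-shift zero e t g))))))
        (≐-sym (shift-cons-zero t (con (coef f e)) (slice zero e g)))))
    where
    L = slice-linear zero e
    h = shift zero t g
  slice-shift (suc i) (k ∷ e) t nil = ≐-refl
  slice-shift (suc i) (zero ∷ e) t (cons f g) =
    ≐-trans (cong (slice-linear (suc i) (zero ∷ e)) (shift-cons-suc i t f g)) (slice-shift i e t f)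
  slice-shift (suc i) (suc k ∷ e) t (cons f g) =
    ≐-trans (cong (slice-linear (suc i) (suc k ∷ e)) (shift-cons-suc i t f g)) (slice-shift (suc i) (k ∷ e) t g)

-- Roots with multiplicity of polynomials in one variable.

module Roots {a ℓ : Level} (F : Field a ℓ) where
  open Field F hiding (zero)
  open Polynomials F
  open Substitutions F
  open import Algebra.Properties.Group +-group using () renaming (x∙y⁻¹≈ε⇒x≈y to x-y≈0⇒x≈y)

  zero-divisor-free : ∀ {c x} → ¬ (c ≈ 0#) → c * x ≈ 0# → x ≈ 0#
  zero-divisor-free {c} {x} c≉0 p with inverse c c≉0
  ... | y , cy≈1 = begin
    x             ≈⟨ *-identityˡ x ⟨
    1# * x        ≈⟨ *-congʳ cy≈1 ⟨
    c * y * x     ≈⟨ *-congʳ (*-comm c y) ⟩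
    y * c * x     ≈⟨ *-assoc y c x ⟩
    y * (c * x)   ≈⟨ *-congˡ p ⟩
    y * 0#        ≈⟨ zeroʳ y ⟩
    0#            ∎
    where open import Relation.Binary.Reasoning.Setoid setoid

  shift-inverse : ∀ t (f : Poly 1) → shift zero (- t) (shift zero t f) ≐ f
  shift-inverse t f = ≐-trans (subst-unique (isSubst-∘ (isSubst (T t)) (isSubst (T (- t)))) f)
    (≐-sym (subst-unique (isSubst-resp {A = translation (λ _ → 0#)} {B = T t ⨟ T (- t)}
      (record { offset≈ = λ { zero → sym (trans
                  (+-cong (*-identityʳ t) (trans (+-identityʳ _) (trans (*-identityˡ _) (*-identityʳ _))))
                  (-‿inverseʳ t)) }
              ; matrix≈ = λ { zero zero → sym (trans (+-identityʳ _) (*-identityˡ _)) } })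
      (id-isSubst {q = λ _ → 0#} (λ _ → refl))) f))
    where
    T : Carrier → Affine 1 1
    T x = translation (λ k → x * δ zero k)

  -- The quotient by x - `t`: move `t` to the origin, drop the constant term together with one
  -- factor x, move back. The remainder is discarded, so the division is exact only at a root.
  divide : Carrier → Poly 1 → Poly 1
  divide t f with shift zero t f
  ... | nil      = nil
  ... | cons _ g = shift zero (- t) g

  -- This is f = (x - t) q translated by `s`; order at least 1 at `t` makes the dropped constant
  -- term zero.
  shift-divide : ∀ s t f {m} → Vanishes (ℕ._< suc m) (shift zero t f) →
    shift zero s f ≐ X zero (shift zero s (divide t f)) ⊞ (s - t) • shift zero s (divide t f)
  shift-divide s t f v with shift zero t f | shift-inverse t f
  ... | nil | p = ≐-trans (cong (shift-linear zero s) (≐-sym p)) (mk≐ λ { (zero ∷ []) → refl ; (suc k ∷ []) → refl })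
  ... | cons (con c) g | p = begin
    shift zero s f
      ≈⟨ cong S p ⟨
    shift zero s (shift zero (- t) (cons (con c) g))
      ≈⟨ cong S (cong (shift-linear zero (- t)) (cons-cong {f = con c} {g = 𝟘} {g} (mk≐ λ { [] → on v (0 ∷ []) (s≤s z≤n) }) ≐-refl)) ⟩
    shift zero s (shift zero (- t) (X zero g))
      ≈⟨ cong S (shift-X zero (- t) zero g) ⟩
    shift zero s (X zero q ⊞ (- t * 1#) • q)
      ≈⟨ add S (X zero q) ((- t * 1#) • q) ⟩
    shift zero s (X zero q) ⊞ shift zero s ((- t * 1#) • q)
      ≈⟨ ⊞-cong (shift-X zero s zero q) (scal S _ q) ⟩
    (X zero h ⊞ (s * 1#) • h) ⊞ (- t * 1#) • h
      ≈⟨ mk≐ collect ⟩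
    X zero h ⊞ (s - t) • h ∎
    where
    open import Relation.Binary.Reasoning.Setoid (≐-setoid 1)
    S = shift-linear zero s
    q = shift zero (- t) g
    h = shift zero s q
    collect : ∀ e → coef ((X zero h ⊞ (s * 1#) • h) ⊞ (- t * 1#) • h) e ≈ coef (X zero h ⊞ (s - t) • h) e
    collect e = trans (coef-⊞ (X zero h ⊞ (s * 1#) • h) ((- t * 1#) • h) e)
      (trans (+-cong (trans (coef-⊞ (X zero h) ((s * 1#) • h) e) (+-congˡ (trans (coef-• _ h e) (*-congʳ (*-identityʳ s)))))
                     (trans (coef-• _ h e) (*-congʳ (*-identityʳ (- t)))))
      (trans (+-assoc _ _ _) (sym (trans (coef-⊞ (X zero h) ((s - t) • h) e) (+-congˡ (trans (coef-• _ h e) (distribʳ _ s (- t))))))))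

  divide-degree : ∀ t f {m} → Vanishes (suc m ℕ.≤_) f → Vanishes (m ℕ.≤_) (divide t f)
  divide-degree t f v with shift zero t f | subst-degree (translation (λ k → t * δ zero k)) (λ _ → ℕ.m≤n⇒m≤1+n) f v
  ... | nil      | w = ≐𝟘⇒vanishes ≐-refl
  ... | cons _ g | w = subst-degree (translation (λ k → - t * δ zero k)) (λ _ → ℕ.m≤n⇒m≤1+n) g
    (vanishes-weaken (λ _ → s≤s) (vanishes-tail w))

  -- The k-th coefficient of (x + c) f is the (k-1)-st of `f` plus c times the k-th, so the
  -- coefficients of `f` vanish one after the other from the lowest.
  cancel-unit : ∀ {c} → ¬ (c ≈ 0#) → ∀ (f : Poly 1) {m} →
    Vanishes (ℕ._< m) (X zero f ⊞ c • f) → Vanishes (ℕ._< m) f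
  cancel-unit {c} c≉0 f {m} v = vanishing λ { (k ∷ []) k<m → go k (≡.subst (ℕ._< m) (ℕ.+-identityʳ k) k<m) }
    where
    expand : ∀ k → coef (X zero f ⊞ c • f) (k ∷ []) ≈ coef (X zero f) (k ∷ []) + c * coef f (k ∷ [])
    expand k = trans (coef-⊞ (X zero f) (c • f) _) (+-congˡ (coef-• c f _))
    step : ∀ k → k ℕ.< m → coef (X zero f) (k ∷ []) ≈ 0# → coef f (k ∷ []) ≈ 0#
    step k k<m p = zero-divisor-free c≉0 (trans (sym (+-identityˡ _)) (trans (+-congʳ (sym p))
      (trans (sym (expand k)) (on v (k ∷ []) (≡.subst (ℕ._< m) (≡.sym (ℕ.+-identityʳ k)) k<m)))))
    go : ∀ k → k ℕ.< m → coef f (k ∷ []) ≈ 0#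
    go zero    k<m = step zero k<m refl
    go (suc k) k<m = step (suc k) k<m (go k (ℕ.<-trans (ℕ.n<1+n k) k<m))

  divide-𝟘 : ∀ t f {m} → Vanishes (ℕ._< suc m) (shift zero t f) → divide t f ≐ 𝟘 → f ≐ 𝟘
  divide-𝟘 t f v p = ≐-trans (≐-sym (shift-inverse t f)) (≐-trans
    (cong L (≐-trans (shift-divide t t f v)
      (≐-trans (⊞-cong (≐-trans (cong (X-linear zero) q) (null (X-linear zero))) (•-cong refl q))
        (≐-trans (⊞-identityˡ _) (•-zeroʳ (t - t))))))
    (null L))
    where
    L = shift-linear zero (- t)
    q = ≐-trans (cong (shift-linear zero t) p) (null (shift-linear zero t))

  -- The factors x - t are divided out one at a time, `m` for each root. Translated to any other
  -- root, x - t has a nonzero constant term, so the order there survives, while the degree bound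
  -- drops by one per factor.
  many-roots⇒𝟘 : ∀ m (ts : List Carrier) → AllPairs (λ s t → ¬ (s ≈ t)) ts → ∀ f →
    All (λ t → Vanishes (ℕ._< m) (shift zero t f)) ts →
    Vanishes (length ts ℕ.* m ℕ.≤_) f → f ≐ 𝟘
  many-roots⇒𝟘 m [] _ f _ d = all⇒≐𝟘 (vanishes-weaken (λ _ _ → z≤n) d)
  many-roots⇒𝟘 m (t ∷ ts) (t≉ts ∷ dist) f (v ∷ vs) d = strip m f v vs d
    where
    -- `b` counts the factors x - t still to be removed.
    strip : ∀ b f → Vanishes (ℕ._< b) (shift zero t f) →
      All (λ t → Vanishes (ℕ._< m) (shift zero t f)) ts →
      Vanishes (b ℕ.+ length ts ℕ.* m ℕ.≤_) f → f ≐ 𝟘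
    strip zero    f v vs d = many-roots⇒𝟘 m ts dist f vs d
    strip (suc b) f v vs d = divide-𝟘 t f v (strip b (divide t f)
      (vanishes-weaken (λ _ → s≤s) (vanishes-tail {f = 𝟘} (vanishes-cong
        (≐-trans (shift-divide t t f v) (≐-trans
          (⊞-congˡ (X zero h) (•-zeroˡ h (-‿inverseʳ t))) (⊞-identityʳ (X zero h)))) v)))
      (All.zipWith (λ { {s} (t≉s , w) → cancel-unit (λ p → t≉s (sym (x-y≈0⇒x≈y s t p))) _
          (vanishes-cong (shift-divide s t f v) w) }) (t≉ts , vs))
      (divide-degree t f d))
      where h = shift zero t (divide t f)

-- Homogeneous linear systems with fewer equations than unknowns.

module LinearAlgebra {a ℓ : Level} (F : Field a ℓ) where
  open Field F hiding (zero)
  open Polynomials F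
  open Substitutions F
  open import Algebra.Properties.Semiring.Sum semiring
    using (∑-distrib-+; *-distribˡ-sum)
    renaming (sum to ∑; sum-cong-≋ to ∑-cong)
  open import Algebra.Properties.Ring ring using (-‿distribʳ-*; -‿distribˡ-*)

  infix 8 _∙_
  _∙_ : ∀ {n} → (Fin n → Carrier) → (Fin n → Carrier) → Carrier
  r ∙ c = ∑ (λ i → r i * c i)

  Nontrivial : ∀ {n} → (Fin n → Carrier) → Set ℓ
  Nontrivial c = ¬ (∀ i → c i ≈ 0#)

  -- `all` says that `pivot` and `rest` exhaust `rows`, in the form in which it is used; this avoids
  -- permutations.
  record Pivot {n} (rows : List (Fin (suc n) → Carrier)) : Set (Level.suc (a ⊔ ℓ)) where
    field
      pivot   : Fin (suc n) → Carrier
      rest    : List (Fin (suc n) → Carrier)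
      nonzero : ¬ (pivot zero ≈ 0#)
      size    : suc (length rest) ≡ length rows
      all     : ∀ (Q : (Fin (suc n) → Carrier) → Set ℓ) → Q pivot → All Q rest → All Q rows

  find-pivot : ∀ {n} (rows : List (Fin (suc n) → Carrier)) →
    ¬ ¬ (All (λ r → r zero ≈ 0#) rows ⊎ Pivot rows)
  find-pivot []         k = k (inj₁ [])
  find-pivot (r ∷ rows) k = ¬¬-excluded-middle λ
    { (no r≉0)  → k (inj₂ record
        { pivot = r ; rest = rows ; nonzero = r≉0 ; size = ≡.refl ; all = λ _ → _∷_ })
    ; (yes r≈0) → find-pivot rows λ
        { (inj₁ rs) → k (inj₁ (r≈0 ∷ rs))
        ; (inj₂ p)  → let open Pivot p in k (inj₂ record
            { pivot = pivot ; rest = r ∷ rest ; nonzero = nonzero ; size = ≡.cong suc size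
            ; all = λ { Q q (q′ ∷ qs) → q′ ∷ all Q q qs } }) } }

  eliminate : ∀ {n} → (Fin (suc n) → Carrier) → Carrier → (Fin (suc n) → Carrier) → Fin n → Carrier
  eliminate p y r i = r (suc i) + - (r zero * y) * p (suc i)

  -- The first unknown is chosen to solve the pivot row `p`, with `y` standing for the inverse of
  -- `p zero`.
  back-substitute : ∀ {n} → (Fin (suc n) → Carrier) → Carrier → (Fin n → Carrier) → Fin (suc n) → Carrier
  back-substitute p y c = - (y * (p ∘ suc) ∙ c) Vector.∷ c

  eliminate-∙ : ∀ {n} (p : Fin (suc n) → Carrier) y r (c : Fin n → Carrier) →
    r ∙ back-substitute p y c ≈ eliminate p y r ∙ c
  eliminate-∙ p y r c = begin
    r zero * - (y * P) + R      ≈⟨ +-comm _ _ ⟩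
    R + r zero * - (y * P)      ≈⟨ +-congˡ (-‿distribʳ-* _ _) ⟨
    R + - (r zero * (y * P))    ≈⟨ +-congˡ (-‿cong (*-assoc _ _ _)) ⟨
    R + - (r zero * y * P)      ≈⟨ +-congˡ (-‿distribˡ-* _ _) ⟩
    R + - (r zero * y) * P      ≈⟨ +-congˡ (*-distribˡ-sum (- (r zero * y)) (λ i → p (suc i) * c i)) ⟩
    R + ∑ (λ i → - (r zero * y) * (p (suc i) * c i))
      ≈⟨ ∑-distrib-+ (λ i → r (suc i) * c i) (λ i → - (r zero * y) * (p (suc i) * c i)) ⟨
    ∑ (λ i → r (suc i) * c i + - (r zero * y) * (p (suc i) * c i))
      ≈⟨ ∑-cong (λ i → trans (+-congˡ (sym (*-assoc _ _ _))) (sym (distribʳ (c i) _ _))) ⟩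
    eliminate p y r ∙ c ∎
    where
    open import Relation.Binary.Reasoning.Setoid setoid
    P = (p ∘ suc) ∙ c
    R = (r ∘ suc) ∙ c

  pivot-∙ : ∀ {n} (p : Fin (suc n) → Carrier) y → p zero * y ≈ 1# → (c : Fin n → Carrier) →
    p ∙ back-substitute p y c ≈ 0#
  pivot-∙ p y py≈1 c = trans (+-congʳ (begin
    p zero * - (y * P)    ≈⟨ -‿distribʳ-* _ _ ⟨
    - (p zero * (y * P))  ≈⟨ -‿cong (*-assoc _ _ _) ⟨
    - (p zero * y * P)    ≈⟨ -‿cong (*-congʳ py≈1) ⟩
    - (1# * P)            ≈⟨ -‿cong (*-identityˡ P) ⟩
    - P ∎)) (-‿inverseˡ P)
    where
    open import Relation.Binary.Reasoning.Setoid setoid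
    P = (p ∘ suc) ∙ c

  nontrivial-kernel : ∀ {n} (rows : List (Fin n → Carrier)) → length rows ℕ.< n →
    ¬ ¬ (Σ (Fin n → Carrier) λ c → Nontrivial c × All (λ r → r ∙ c ≈ 0#) rows)
  nontrivial-kernel {suc n} rows (s≤s len≤n) k = find-pivot rows λ
    -- No equation involves the first unknown, so the first unit vector is a solution.
    { (inj₁ zeros) → k (δ zero , (λ z → 0≉1 (sym (z zero))) ,
        All.map (λ {r} r≈0 → trans (∑-δʳ′ r) r≈0) zeros)
    ; (inj₂ p) → let open Pivot p
                     y , py≈1 = inverse (pivot zero) nonzero in
        nontrivial-kernel (List.map (eliminate pivot y) rest)
          (≡.subst (ℕ._≤ n) (≡.trans (≡.sym size) (≡.cong suc (≡.sym (length-map _ rest)))) len≤n)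
          λ { (c , c≉0 , sol) → k (back-substitute pivot y c , (λ z → c≉0 (z ∘ suc)) ,
            all _ (pivot-∙ pivot y py≈1 c)
              (All.map (λ {r} q → trans (eliminate-∙ pivot y r c) q) (All.map⁻ sol))) } }
    where
    ∑-δʳ′ : ∀ (r : Fin (suc n) → Carrier) → r ∙ δ zero ≈ r zero
    ∑-δʳ′ r = trans (+-cong (*-identityʳ _) (∑-zero {u = λ i → r (suc i) * 0#} (λ i → zeroʳ _))) (+-identityʳ _)

  -- The vanishing conditions are coefficients of substituted polynomials. Treating them as abstract
  -- functionals avoids computing their rows, which `form-row` recovers from the unit vectors.
  record LinearForm (n : ℕ) : Set (a ⊔ ℓ) where
    field
      app    : (Fin n → Carrier) → Carrier
      app-≈  : ∀ {c d} → (∀ i → c i ≈ d i) → app c ≈ app d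
      app-+  : ∀ c d → app (λ i → c i + d i) ≈ app c + app d
      app-*  : ∀ x c → app (λ i → x * c i) ≈ x * app c
  open LinearForm

  tailForm : ∀ {n} → LinearForm (suc n) → LinearForm n
  tailForm f = record
    { app = λ c → app f (0# Vector.∷ c)
    ; app-≈ = λ p → app-≈ f λ { zero → refl ; (suc i) → p i }
    ; app-+ = λ c d → trans (app-≈ f λ { zero → sym (+-identityˡ 0#) ; (suc i) → refl }) (app-+ f _ _)
    ; app-* = λ x c → trans (app-≈ f λ { zero → sym (zeroʳ x) ; (suc i) → refl }) (app-* f x _)
    }

  form-row : ∀ {n} (f : LinearForm n) c → app f c ≈ (λ i → app f (δ i)) ∙ c
  form-row {zero} f c = trans (app-≈ f {c} {λ i → 0# * c i} λ ()) (trans (app-* f 0# c) (zeroˡ _))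
  form-row {suc n} f c = begin
    app f c
      ≈⟨ app-≈ f {c} {λ i → c zero * δ zero i + (0# Vector.∷ (c ∘ suc)) i} (λ
          { zero → sym (trans (+-identityʳ _) (*-identityʳ _))
          ; (suc i) → sym (trans (+-congʳ (zeroʳ _)) (+-identityˡ _)) }) ⟩
    app f (λ i → c zero * δ zero i + (0# Vector.∷ (c ∘ suc)) i)
      ≈⟨ app-+ f _ _ ⟩
    app f (λ i → c zero * δ zero i) + app f (0# Vector.∷ (c ∘ suc))
      ≈⟨ +-cong (trans (app-* f (c zero) (δ zero)) (*-comm _ _)) (form-row (tailForm f) (c ∘ suc)) ⟩
    app f (δ zero) * c zero + ∑ (λ i → app f (0# Vector.∷ δ i) * c (suc i))
      ≈⟨ +-congˡ (∑-cong {x = λ i → app f (0# Vector.∷ δ i) * c (suc i)} {λ i → app f (δ (suc i)) * c (suc i)}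
            (λ i → *-congʳ (app-≈ f λ { zero → refl ; (suc j) → refl }))) ⟩
    (λ i → app f (δ i)) ∙ c ∎
    where open import Relation.Binary.Reasoning.Setoid setoid

  common-zero : ∀ {n} (fs : List (LinearForm n)) → length fs ℕ.< n →
    ¬ ¬ (Σ (Fin n → Carrier) λ c → Nontrivial c × All (λ f → app f c ≈ 0#) fs)
  common-zero {n} fs len k = nontrivial-kernel (List.map (λ f i → app f (δ i)) fs)
    (≡.subst (ℕ._< n) (≡.sym (length-map _ fs)) len)
    λ { (c , c≉0 , sol) → k (c , c≉0 , All.map (λ {f} q → trans (form-row f c) q) (All.map⁻ sol)) }

  -- Polynomials of bounded degree in each variable.

  tabulate : ∀ {n E} → (Fin E → Poly n) → Poly (suc n)
  tabulate {E = zero}  v = nil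
  tabulate {E = suc E} v = cons (v zero) (tabulate (v ∘ suc))

  tabulate-cong : ∀ {n E} {v w : Fin E → Poly n} → (∀ i → v i ≐ w i) → tabulate v ≐ tabulate w
  tabulate-cong {E = zero}  p = ≐-refl
  tabulate-cong {E = suc E} p = cons-cong (p zero) (tabulate-cong (p ∘ suc))

  tabulate-⊞ : ∀ {n E} (v w : Fin E → Poly n) → tabulate (λ i → v i ⊞ w i) ≐ tabulate v ⊞ tabulate w
  tabulate-⊞ {E = zero}  v w = ≐-refl
  tabulate-⊞ {E = suc E} v w = cons-cong ≐-refl (tabulate-⊞ (v ∘ suc) (w ∘ suc))

  tabulate-• : ∀ {n E} c (v : Fin E → Poly n) → tabulate (λ i → c • v i) ≐ c • tabulate v
  tabulate-• {E = zero}  c v = ≐-refl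
  tabulate-• {E = suc E} c v = cons-cong ≐-refl (tabulate-• c (v ∘ suc))

  tabulate-𝟘 : ∀ {n E} (v : Fin E → Poly n) → tabulate v ≐ 𝟘 → ∀ i → v i ≐ 𝟘
  tabulate-𝟘 v p zero    = mk≐ λ e → trans (at p (zero ∷ e)) (sym (coef-𝟘 e))
  tabulate-𝟘 v p (suc i) = tabulate-𝟘 (v ∘ suc) (mk≐ λ { (k ∷ e) → at p (suc k ∷ e) }) i

  tabulate-vanishes : ∀ {n E C} (v : Fin E → Poly n) → (∀ i → Vanishes (C ∘ (toℕ i ℕ.+_)) (v i)) →
    Vanishes C (tabulate v)
  tabulate-vanishes {E = zero}  v p = ≐𝟘⇒vanishes ≐-refl
  tabulate-vanishes {E = suc E} v p = vanishes-cons (p zero) (tabulate-vanishes (v ∘ suc) (p ∘ suc))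

  module Box (E : ℕ) where

    block : ∀ n → (Fin (E ^ suc n) → Carrier) → Fin E → Fin (E ^ n) → Carrier
    block n c i j = c (combine {E} {E ^ n} i j)

    -- The general polynomial of degree below `E` in each variable, as a function of its
    -- coefficients, which are the unknowns of the linear system. By `box-𝟘` a nontrivial solution
    -- is a nonzero polynomial.
    box : ∀ n → (Fin (E ^ n) → Carrier) → Poly n
    box zero    c = con (c zero)
    box (suc n) c = tabulate {E = E} (λ i → box n (block n c i))

    box-cong : ∀ n {c d : Fin (E ^ n) → Carrier} → (∀ i → c i ≈ d i) → box n c ≐ box n d
    box-cong zero    p = mk≐ λ { [] → p zero }
    box-cong (suc n) p = tabulate-cong (λ (i : Fin E) → box-cong n (λ j → p (combine {E} {E ^ n} i j)))

    box-⊞ : ∀ n (c d : Fin (E ^ n) → Carrier) → box n (λ i → c i + d i) ≐ box n c ⊞ box n d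
    box-⊞ zero    c d = ≐-refl
    box-⊞ (suc n) c d = ≐-trans (tabulate-cong (λ (i : Fin E) → box-⊞ n (block n c i) (block n d i)))
      (tabulate-⊞ (λ i → box n (block n c i)) (λ i → box n (block n d i)))

    box-• : ∀ n x (c : Fin (E ^ n) → Carrier) → box n (λ i → x * c i) ≐ x • box n c
    box-• zero    x c = ≐-refl
    box-• (suc n) x c = ≐-trans (tabulate-cong (λ (i : Fin E) → box-• n x (block n c i)))
      (tabulate-• x (λ i → box n (block n c i)))

    box-𝟘 : ∀ n (c : Fin (E ^ n) → Carrier) → box n c ≐ 𝟘 → ∀ i → c i ≈ 0#
    box-𝟘 zero    c p zero = at p []
    box-𝟘 (suc n) c p i = ≡.subst (λ j → c j ≈ 0#) (combine-remQuot {E} (E ^ n) i)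
      (let q , r = remQuot {E} (E ^ n) i in
        box-𝟘 n (block n c q) (tabulate-𝟘 (λ i → box n (block n c i)) p q) r)

    -- Each variable contributes at most `pred E`. For three variables and side J the total degree
    -- is at most 3(J - 1).
    box-degree : ∀ n (c : Fin (E ^ n) → Carrier) → Vanishes (n ℕ.* ℕ.pred E ℕ.<_) (box n c)
    box-degree zero    c = vanishing λ { [] () }
    box-degree (suc n) c = tabulate-vanishes (λ i → box n (block n c i)) λ i →
      vanishes-weaken (λ k lt → ℕ.+-cancelˡ-< (ℕ.pred E) (n ℕ.* ℕ.pred E) k
          (ℕ.<-≤-trans lt (ℕ.+-monoˡ-≤ k (toℕ≤pred[n] i))))
        (box-degree n (block n c i))

    coef-form : ∀ {m} n (ψ : Poly n → Poly m) → IsLinear ψ → Vec ℕ m → LinearForm (E ^ n)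
    coef-form n ψ lin e = record
      { app = λ c → coef (ψ (box n c)) e
      ; app-≈ = λ p → at (cong lin (box-cong n p)) e
      ; app-+ = λ c d → trans (at (≐-trans (cong lin (box-⊞ n c d)) (add lin (box n c) (box n d))) e)
                              (coef-⊞ (ψ (box n c)) _ e)
      ; app-* = λ x c → trans (at (≐-trans (cong lin (box-• n x c)) (scal lin x (box n c))) e)
                              (coef-• x (ψ (box n c)) e)
      }

AllPairs-map-All : ∀ {a p r s} {A : Set a} {P : A → Set p} {R : A → A → Set r} {S : A → A → Set s} →
  (∀ {x y} → P x → P y → R x y → S x y) → ∀ {xs} → All P xs → AllPairs R xs → AllPairs S xs
AllPairs-map-All f []       []       = []
AllPairs-map-All f (p ∷ ps) (r ∷ rs) = All.zipWith (λ { (q , x) → f p q x }) (ps , r) ∷ AllPairs-map-All f ps rs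

sum-insertAt : ∀ {n} (e : Vec ℕ n) i k → Vec.sum (insertAt e i k) ≡ k ℕ.+ Vec.sum e
sum-insertAt e       zero    k = ≡.refl
sum-insertAt (x ∷ e) (suc i) k = ≡.trans (≡.cong (x ℕ.+_) (sum-insertAt e i k))
  (≡.trans (≡.sym (ℕ.+-assoc x k _)) (≡.trans (≡.cong (ℕ._+ Vec.sum e) (ℕ.+-comm x k)) (ℕ.+-assoc k x _)))

-- Joints and the coordinates given by their lines.

module Joints {a ℓ : Level} (F : Field a ℓ) (family : Fin 3 → List (Geometry.Line F)) where
  open Field F hiding (zero)
  open Geometry F
  open Polynomials F hiding (at)
  open Substitutions F
  open Roots F
  open LinearAlgebra F
  open import Algebra.Properties.Semiring.Sum semiring
    using () renaming (sum to ∑; sum-cong-≋ to ∑-cong)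

  L : Fin 3 → ℕ
  L k = length (family k)

  -- A multijoint with a chosen line from each family. Lines are named by position, since equality
  -- of positions is decidable and equality of lines need not be. The columns of `directions` are
  -- the directions of the three lines.
  record Joint : Set (a ⊔ ℓ) where
    field
      point     : Vec3
      index     : ∀ k → Fin (L k)
      incidence : ∀ k → point ∈L List.lookup (family k) (index k)

    through : Fin 3 → Line
    through k = List.lookup (family k) (index k)

    directions : Fin 3 → Fin 3 → Carrier
    directions i k = dir (through k) i

    field
      spanning : ∀ (z : Vec3) → Σ (Fin 3 → Carrier) λ α → ∀ i → z i ≈ ∑ (λ k → directions i k * α k)

    frame : Affine 3 3
    frame = affine point directions

    param : Fin 3 → Carrier
    param k = proj₁ (incidence k)
  open Joint

  ∑-0ʳ : ∀ {n} (u : Fin n → Carrier) → ∑ (λ k → u k * 0#) ≈ 0#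
  ∑-0ʳ u = ∑-zero {u = λ k → u k * 0#} (λ k → zeroʳ (u k))

  -- The order of vanishing at a joint carries over to any directions: those of `j` span, so `D` is
  -- their matrix times some `K`, and the substitution by `K` is homogeneous.
  reframe : ∀ (j : Joint) (D : Fin 3 → Fin 3 → Carrier) {C} g → Vanishes C (subst (frame j) g) →
    Vanishes C (subst (affine (point j) D) g)
  reframe j D g v = vanishes-cong (subst-⨟ {A = frame j} {affine (λ _ → 0#) K} {affine (point j) D} (record
      { offset≈ = λ i → trans (+-congˡ (∑-0ʳ (directions j i))) (+-identityʳ _)
      ; matrix≈ = λ i l → sym (proj₂ (spanning j (λ i → D i l)) i) }) g)
    (subst-vanishes (affine (λ _ → 0#) K) (λ _ → refl) (subst (frame j) g) v)
    where
    K : Fin 3 → Fin 3 → Carrier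
    K k l = proj₁ (spanning j (λ i → D i l)) k

  -- `reframe` with the identity matrix shows that the translate of `g` to the joint is zero;
  -- translating back recovers `g`.
  frame-injective : ∀ (j : Joint) g → subst (frame j) g ≐ 𝟘 → g ≐ 𝟘
  frame-injective j g p = ≐-trans (subst-unique (id-isSubst {q = λ _ → 0#} (λ _ → refl)) g)
    (≐-trans (≐-sym (subst-⨟ {A = translation (point j)} {translation (λ i → - point j i)} (record
      { offset≈ = λ i → trans (+-congˡ (∑-δ i (λ k → - point j k))) (-‿inverseʳ _)
      ; matrix≈ = λ i l → ∑-δ i (λ k → δ k l) }) g))
    (≐-trans (cong (subst-linear T) (all⇒≐𝟘 (reframe j δ g (≐𝟘⇒vanishes p)))) (null (subst-linear T))))
    where T = translation (λ i → - point j i)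

  -- Translating the `k`-th frame coordinate moves the origin along the `k`-th direction; this is
  -- how the frame of one joint reaches the others on its line.
  shift-frame : ∀ (q q′ : Vec3) (D : Fin 3 → Fin 3 → Carrier) k t → (∀ i → q′ i ≈ q i + t * D i k) → ∀ g →
    shift k t (subst (affine q D) g) ≐ subst (affine q′ D) g
  shift-frame q q′ D k t p = subst-⨟ {A = affine q D} {translation (λ l → t * δ k l)} (record
    { offset≈ = λ i → trans (+-congˡ (trans (∑-cong {x = λ l → D i l * (t * δ k l)} {λ l → δ k l * (t * D i l)}
          (λ l → trans (sym (*-assoc _ _ _)) (trans (*-comm _ _) (*-congˡ (*-comm _ _)))))
        (∑-δ k (λ l → t * D i l)))) (sym (p i))
    ; matrix≈ = λ i l → ∑-δʳ l (D i) })

  onLine : ∀ k (j j′ : Joint) → index j′ k ≡ index j k →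
    ∀ i → point j′ i ≈ base (through j k) i + param j′ k * directions j i k
  onLine k j j′ eq = ≡.subst (λ x → ∀ i → point j′ i ≈
      base (List.lookup (family k) x) i + param j′ k * dir (List.lookup (family k) x) i)
    eq (proj₂ (incidence j′ k))

  displacement : ∀ k (j j′ : Joint) → index j′ k ≡ index j k →
    ∀ i → point j′ i ≈ point j i + (param j′ k - param j k) * directions j i k
  displacement k j j′ eq i = sym (begin
    point j i + (t′ - t) * d       ≈⟨ +-congʳ (onLine k j j ≡.refl i) ⟩
    b + t * d + (t′ - t) * d       ≈⟨ +-assoc _ _ _ ⟩
    b + (t * d + (t′ - t) * d)     ≈⟨ +-congˡ (distribʳ d t (t′ - t)) ⟨
    b + (t + (t′ - t)) * d         ≈⟨ +-congˡ (*-congʳ (begin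
        t + (t′ - t) ≈⟨ +-comm _ _ ⟩
        t′ - t + t   ≈⟨ +-assoc _ _ _ ⟩
        t′ + (- t + t) ≈⟨ +-congˡ (-‿inverseˡ t) ⟩
        t′ + 0#      ≈⟨ +-identityʳ t′ ⟩
        t′ ∎)) ⟩
    b + t′ * d                     ≈⟨ onLine k j j′ eq i ⟨
    point j′ i ∎)
    where
    open import Relation.Binary.Reasoning.Setoid setoid
    d = directions j i k
    b = base (through j k) i
    t = param j k
    t′ = param j′ k

  -- Only joints assigned to the line through `index` are counted; a joint that merely lies on it is
  -- not.
  companions : List Joint → ∀ k → Fin (L k) → List Joint
  companions js k x = filter (λ j → index j k Fin.≟ x) js

  -- Vanishing to every order at rich joints.

  module _ (js : List Joint) (distinct : AllPairs (λ i j → ¬ (point i ≋ point j)) js)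
    (d : ℕ) (s : Fin 3 → ℕ)
    -- Zeros of order `m` at all joints of such a line outnumber the degree bound `d`.
    (rich : ∀ {j} → j ∈ js → ∀ k {m} → s k ℕ.≤ m → d ℕ.< length (companions js k (index j k)) ℕ.* m)
    (g : Poly 3) (degree : Vanishes (d ℕ.<_) g)
    (low : ∀ {j} → j ∈ js → ∀ e → (∀ k → Vec.lookup e k ℕ.< s k) → coef (subst (frame j) g) e ≈ 0#)
    where

    -- Along the k-th line of j the slice has degree ≤ d but vanishes to order m at too many joints.
    slice-𝟘 : ∀ {j r} → j ∈ js → (∀ {j′} → j′ ∈ js → Vanishes (ℕ._< r) (subst (frame j′) g)) →
      ∀ (k : Fin 3) (e : Vec ℕ 2) m → s k ℕ.≤ m → m ℕ.+ Vec.sum e ≡ r →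
      slice k e (subst (frame j) g) ≐ 𝟘
    slice-𝟘 {j} {r} j∈ ih k e m s≤m sum≡r = many-roots⇒𝟘 m (List.map t cs)
      (AllPairs.map⁺ (AllPairs-map-All (λ {j₁} {j₂} → t-distinct j₁ j₂) same (AllPairs.filter⁺ (λ j′ → index j′ k Fin.≟ index j k) distinct)))
      (slice k e G)
      (All.map⁺ (All.tabulate λ j′∈ → order (proj₁ (∈-filter⁻ _ j′∈)) (proj₂ (∈-filter⁻ _ {xs = js} j′∈))))
      -- The exponent `x` within the slice is at most the total exponent, so once it reaches the
      -- number of roots the total exceeds `d`.
      (vanishing λ { (x ∷ []) le → trans (coef-slice k e G x) (on (subst-degree (frame j) (λ _ → ℕ.m<n⇒m<1+n) g degree) _
        (ℕ.<-≤-trans (rich j∈ k s≤m) (ℕ.≤-trans (≡.subst (λ z → z ℕ.* m ℕ.≤ x ℕ.+ 0) (length-map t cs) le)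
          (≡.subst (x ℕ.+ 0 ℕ.≤_) (≡.sym (sum-insertAt e k x)) (ℕ.+-monoʳ-≤ x z≤n))))) })
      where
      G = subst (frame j) g
      cs = companions js k (index j k)
      t : Joint → Carrier
      t j′ = param j′ k - param j k
      same : All (λ j′ → index j′ k ≡ index j k) cs
      same = All.tabulate λ j′∈ → proj₂ (∈-filter⁻ (λ j′ → index j′ k Fin.≟ index j k) {xs = js} j′∈)
      t-distinct : ∀ j₁ j₂ → index j₁ k ≡ index j k → index j₂ k ≡ index j k →
        ¬ (point j₁ ≋ point j₂) → ¬ (t j₁ ≈ t j₂)
      t-distinct j₁ j₂ eq₁ eq₂ ne t≈ = ne λ i → trans (displacement k j j₁ eq₁ i)
        (trans (+-congˡ (*-congʳ t≈)) (sym (displacement k j j₂ eq₂ i)))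
      -- The translated slice is a slice of `g` in a frame at `j′` with the directions of `j`, where
      -- `ih` holds by `reframe`. Exponents below `m` in the slice have total below `m` plus the sum
      -- of `e`, which is `r`.
      order : ∀ {j′} → j′ ∈ js → index j′ k ≡ index j k → Vanishes (ℕ._< m) (shift zero (t j′) (slice k e G))
      order {j′} j′∈ eq = vanishes-cong (slice-shift k e (t j′) G)
        (vanishing λ { (x ∷ []) x<m → trans (coef-slice k e _ x)
          (on (vanishes-cong (≐-sym (shift-frame (point j) (point j′) (directions j) k (t j′) (displacement k j j′ eq) g))
              (reframe j′ (directions j) g (ih j′∈))) _
            (≡.subst₂ ℕ._<_ (≡.sym (sum-insertAt e k x)) sum≡r
              (ℕ.+-monoˡ-< (Vec.sum e) (≡.subst (ℕ._< m) (ℕ.+-identityʳ x) x<m)))) })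

    -- All joints advance together, since raising the order at one joint uses the current order at
    -- the others on its line.
    vanishes-to-order : ∀ r {j} → j ∈ js → Vanishes (ℕ._< r) (subst (frame j) g)
    vanishes-to-order zero    j∈ = vanishing λ _ ()
    vanishes-to-order (suc r) {j} j∈ = vanishing λ e e<1+r → go e (ℕ.m≤n⇒m<n∨m≡n (ℕ.≤-pred e<1+r))
      where
      go : ∀ e → Vec.sum e ℕ.< r ⊎ Vec.sum e ≡ r → coef (subst (frame j) g) e ≈ 0#
      go e (inj₁ lt) = on (vanishes-to-order r j∈) e lt
      go e (inj₂ eq) with Fin.any? (λ k → s k ℕ.≤? Vec.lookup e k)
      ... | no none = low j∈ e (λ k → ℕ.≰⇒> λ le → none (k , le))
      ... | yes (k , le) = ≡.subst (λ e → coef (subst (frame j) g) e ≈ 0#) (insertAt-removeAt e k)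
        (trans (sym (coef-slice k (removeAt e k) (subst (frame j) g) (Vec.lookup e k)))
          (_≐_.at (slice-𝟘 j∈ (vanishes-to-order r) k (removeAt e k) (Vec.lookup e k) le
            (≡.trans (≡.sym (sum-insertAt (removeAt e k) k (Vec.lookup e k)))
              (≡.trans (≡.cong Vec.sum (insertAt-removeAt e k)) eq)))
           (Vec.lookup e k ∷ [])))

    low⇒𝟘 : ∀ {j} → j ∈ js → g ≐ 𝟘
    low⇒𝟘 {j} j∈ = frame-injective j g (all⇒≐𝟘 (vanishing λ e _ →
      on (vanishes-to-order (suc (Vec.sum e)) j∈) e (ℕ.n<1+n _)))

open import Data.Nat using (_+_; _*_; _<_; _≤_; _≤?_; NonZero; _/_)
open import Data.Nat.DivMod using (m/n*n≤m; m≡m%n+[m/n]*n; m%n<n)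
open import Data.Nat.ListAction using (sum)
open import Data.Nat.ListAction.Properties using (sum-++)
open import Data.List using (_++_; allFin; concatMap; upTo; cartesianProductWith)
open import Data.List.Properties using (map-++; length-++; length-tabulate; length-filter; length-upTo)
open import Data.List.Membership.Propositional using (find)
open import Data.List.Relation.Unary.Any as Any using (here; there)
open import Data.List.Relation.Unary.Any.Properties using (lookup-index)

-- Discarding colours with few members.

length-filter-¬ : ∀ {a p} {A : Set a} {P : Pred A p} (P? : Decidable P) xs →
  length xs ≡ length (filter P? xs) + length (filter (¬? ∘ P?) xs)
length-filter-¬ P? [] = ≡.refl
length-filter-¬ P? (x ∷ xs) with P? x
... | yes _ = ≡.cong suc (length-filter-¬ P? xs)
... | no  _ = ≡.trans (≡.cong suc (length-filter-¬ P? xs))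
  (≡.sym (ℕ.+-suc (length (filter P? xs)) (length (filter (¬? ∘ P?) xs))))

module Pruning {a k r : Level} {A : Set a} {K : Set k} {_~_ : A → K → Set r}
  (_~?_ : ∀ x c → Dec (x ~ c)) (θ : K → ℕ) where

  members : K → List A → List A
  members c = filter (_~? c)

  record Pruned {d} (D : Rel A d) (xs : List A) : Set (a ⊔ k ⊔ r ⊔ d) where
    field
      kept     : List A
      kept⊆    : ∀ {x} → x ∈ kept → x ∈ xs
      size     : length kept ≤ length xs
      nonempty : 0 < length kept
      distinct : AllPairs D kept
      rich     : ∀ {x} → x ∈ kept → ∀ c → x ~ c → θ c < length (members c kept)

  -- Induction on the number of colours left. A poor colour goes together with its members, at most
  -- `θ c` of them, so the total quota stays below the number of survivors. `cover` keeps every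
  -- occurring colour in the list: when none listed is poor, all survivors are rich.
  prune : ∀ {d} {D : Rel A d} n (C : List K) → length C ≡ n → (xs : List A) → AllPairs D xs →
    (∀ {x} → x ∈ xs → ∀ c → x ~ c → c ∈ C) → sum (map θ C) < length xs → Pruned D xs
  prune n C len xs dist cover θ<xs with Any.any? (λ c → length (members c xs) ≤? θ c) C
  ... | no none = record
    { kept = xs ; kept⊆ = id ; size = ℕ.≤-refl ; nonempty = ℕ.≤-<-trans z≤n θ<xs ; distinct = dist
    ; rich = λ x∈xs c x~c → ℕ.≰⇒> λ le → none (Any.map (λ { ≡.refl → le }) (cover x∈xs c x~c)) }
  prune zero    []       len xs dist cover θ<xs | yes ()
  prune (suc n) C@(_ ∷ _) len xs dist cover θ<xs | yes poor with find poor
  ... | c , c∈C , few with ∈-∃++ c∈C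
  ... | ys , zs , C≡ = record
    { kept = kept ; kept⊆ = proj₁ ∘ ∈-filter⁻ _ ∘ kept⊆
    ; size = ℕ.≤-trans size (length-filter (¬? ∘ (_~? c)) xs)
    ; nonempty = nonempty ; distinct = distinct ; rich = rich }
    where
    open ≡.≡-Reasoning
    xs′ = filter (¬? ∘ (_~? c)) xs
    len′ : length (ys ++ zs) ≡ n
    len′ = ℕ.suc-injective (begin
      suc (length (ys ++ zs))       ≡⟨ ≡.cong suc (length-++ ys) ⟩
      suc (length ys + length zs)   ≡⟨ ℕ.+-suc (length ys) (length zs) ⟨
      length ys + suc (length zs)   ≡⟨ length-++ ys ⟨
      length (ys ++ c ∷ zs)         ≡⟨ ≡.cong length C≡ ⟨
      length C                      ≡⟨ len ⟩
      suc n                         ∎)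
    cover′ : ∀ {x} → x ∈ xs′ → ∀ c′ → x ~ c′ → c′ ∈ ys ++ zs
    cover′ x∈ c′ x~c′ with ∈-filter⁻ (¬? ∘ (_~? c)) x∈
    ... | x∈xs , x≁c with ∈-++⁻ ys (≡.subst (c′ ∈_) C≡ (cover x∈xs c′ x~c′))
    ... | inj₁ p             = ∈-++⁺ˡ p
    -- No survivor has colour `c`, so the list may lose this occurrence of it.
    ... | inj₂ (here ≡.refl) = contradiction x~c′ x≁c
    ... | inj₂ (there p)     = ∈-++⁺ʳ ys p
    ΣC : sum (map θ C) ≡ θ c + sum (map θ (ys ++ zs))
    ΣC = begin
      sum (map θ C)                                   ≡⟨ ≡.cong (sum ∘ map θ) C≡ ⟩
      sum (map θ (ys ++ c ∷ zs))                      ≡⟨ ≡.cong sum (map-++ θ ys (c ∷ zs)) ⟩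
      sum (map θ ys ++ θ c ∷ map θ zs)                ≡⟨ sum-++ (map θ ys) (θ c ∷ map θ zs) ⟩
      sum (map θ ys) + (θ c + sum (map θ zs))         ≡⟨ ℕ.+-assoc (sum (map θ ys)) (θ c) _ ⟨
      sum (map θ ys) + θ c + sum (map θ zs)           ≡⟨ ≡.cong (_+ sum (map θ zs)) (ℕ.+-comm (sum (map θ ys)) (θ c)) ⟩
      θ c + sum (map θ ys) + sum (map θ zs)           ≡⟨ ℕ.+-assoc (θ c) _ _ ⟩
      θ c + (sum (map θ ys) + sum (map θ zs))         ≡⟨ ≡.cong (θ c +_) (sum-++ (map θ ys) (map θ zs)) ⟨
      θ c + sum (map θ ys ++ map θ zs)                ≡⟨ ≡.cong (λ l → θ c + sum l) (map-++ θ ys zs) ⟨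
      θ c + sum (map θ (ys ++ zs))                    ∎
    θ<xs′ : sum (map θ (ys ++ zs)) < length xs′
    θ<xs′ = ℕ.+-cancelˡ-< (θ c) _ _ (ℕ.<-≤-trans
      (≡.subst₂ _<_ ΣC (length-filter-¬ (_~? c) xs) θ<xs)
      (ℕ.+-monoˡ-≤ _ few))
    open Pruned (prune n (ys ++ zs) len′ xs′ (AllPairs.filter⁺ (¬? ∘ (_~? c)) dist) cover′ θ<xs′)

-- Quotas of the lines and the number of vanishing conditions.

sum-map-const : ∀ {a b} {A : Set a} {B : Set b} (θ : B → ℕ) m (f : A → B) → (∀ x → θ (f x) ≡ m) →
  ∀ xs → sum (map θ (map f xs)) ≡ length xs * m
sum-map-const θ m f p [] = ≡.refl
sum-map-const θ m f p (x ∷ xs) = ≡.cong₂ _+_ (p x) (sum-map-const θ m f p xs)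

-- A colour is a line, named by its family and its position there; a joint has three colours.
colours : (L : Fin 3 → ℕ) → List (Σ (Fin 3) (Fin ∘ L))
colours L = concatMap (λ k → map (k ,_) (allFin (L k))) (allFin 3)

∈-colours : ∀ L c → c ∈ colours L
∈-colours L (k , c) = ∈-concatMap⁺ (λ k → map (k ,_) (allFin (L k)))
  (Any.map (λ { ≡.refl → ∈-map⁺ (k ,_) (∈-allFin c) }) (∈-allFin k))

sum-colours : ∀ L (θ : Fin 3 → ℕ) → sum (map (θ ∘ proj₁) (colours L)) ≡
  L zero * θ zero + (L (suc zero) * θ (suc zero) + L (suc (suc zero)) * θ (suc (suc zero)))
sum-colours L θ = begin
  sum (map (θ ∘ proj₁) (colours L))
    ≡⟨ part zero _ ⟩
  L zero * θ zero + sum (map (θ ∘ proj₁) (row (suc zero) ++ row (suc (suc zero)) ++ []))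
    ≡⟨ ≡.cong (L zero * θ zero +_) (≡.trans (part (suc zero) _)
         (≡.cong (L (suc zero) * θ (suc zero) +_) (≡.trans (part (suc (suc zero)) []) (ℕ.+-identityʳ _)))) ⟩
  _ ∎
  where
  open ≡.≡-Reasoning
  row : ∀ k → List (Σ (Fin 3) (Fin ∘ L))
  row k = map (k ,_) (allFin (L k))
  part : ∀ k ys → sum (map (θ ∘ proj₁) (row k ++ ys)) ≡ L k * θ k + sum (map (θ ∘ proj₁) ys)
  part k ys = ≡.trans (≡.cong sum (map-++ (θ ∘ proj₁) (row k) ys))
    (≡.trans (sum-++ (map (θ ∘ proj₁) (row k)) _)
      (≡.cong (_+ sum (map (θ ∘ proj₁) ys))
        (≡.trans (sum-map-const {B = Σ (Fin 3) (Fin ∘ L)} (θ ∘ proj₁) (θ k) (k ,_) (λ _ → ≡.refl) (allFin (L k)))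
          (≡.cong (_* θ k) (length-tabulate {n = L k} id)))))

m<[1+m/n]*n : ∀ m n .{{_ : NonZero n}} → m < suc (m / n) * n
m<[1+m/n]*n m n = ≡.subst (_< suc (m / n) * n) (≡.sym (m≡m%n+[m/n]*n m n)) (ℕ.+-monoˡ-< _ (m%n<n m n))

-- Lines of the k-th family carrying at most this many points are discarded.
quota : ℕ → (L : Fin 3 → ℕ) → (∀ k → NonZero (4 * L k)) → Fin 3 → ℕ
quota J L nz k = _/_ J (4 * L k) {{nz k}}

-- L times the integer part of J / (4 L) is at most J / 4, so the three families account for at most
-- 3J / 4, which is below J because J is positive.
sum-quota : ∀ J L nz → 0 < J → sum (map (quota J L nz ∘ proj₁) (colours L)) < J
sum-quota J L nz 0<J = ≡.subst (_< J) (≡.sym (sum-colours L (quota J L nz))) (ℕ.*-cancelˡ-< 4 _ _ (begin-strict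
  4 * (t zero + (t (suc zero) + t (suc (suc zero))))
    ≡⟨ ≡.trans (ℕ.*-distribˡ-+ 4 (t zero) _) (≡.cong (4 * t zero +_) (ℕ.*-distribˡ-+ 4 (t (suc zero)) _)) ⟩
  4 * t zero + (4 * t (suc zero) + 4 * t (suc (suc zero)))
    ≤⟨ ℕ.+-mono-≤ (bound zero) (ℕ.+-mono-≤ (bound (suc zero)) (bound (suc (suc zero)))) ⟩
  J + (J + J)
    <⟨ ℕ.+-monoʳ-< J (ℕ.+-monoʳ-< J (ℕ.+-mono-<-≤ 0<J ℕ.≤-refl)) ⟩
  J + (J + (J + J))
    ≡⟨ ≡.cong (λ x → J + (J + (J + x))) (ℕ.+-identityʳ J) ⟨
  4 * J ∎))
  where
  open ℕ.≤-Reasoning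
  t : Fin 3 → ℕ
  t k = L k * quota J L nz k
  bound : ∀ k → 4 * t k ≤ J
  bound k = ≡.subst (_≤ J) (≡.trans (ℕ.*-comm _ (4 * L k)) (ℕ.*-assoc 4 (L k) _)) (m/n*n≤m J (4 * L k) {{nz k}})

-- Exceeding the quota means at least J after multiplication by 4 `L k`; the remaining factor 3 in
-- 12 serves to beat a degree below 3J.
quota-rich : ∀ J L nz k {n m} → quota J L nz k < n → 12 * L k ≤ m → J + (J + J) ≤ n * m
quota-rich J L nz k {n} {m} q<n s≤m = begin
  J + (J + J)                 ≡⟨ ≡.cong (λ x → J + (J + x)) (ℕ.+-identityʳ J) ⟨
  3 * J                       ≤⟨ ℕ.*-monoʳ-≤ 3 (ℕ.<⇒≤ (m<[1+m/n]*n J (4 * L k) {{nz k}})) ⟩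
  3 * (suc q * (4 * L k))     ≤⟨ ℕ.*-monoʳ-≤ 3 (ℕ.*-monoˡ-≤ (4 * L k) q<n) ⟩
  3 * (n * (4 * L k))         ≡⟨ ℕ.*-comm 3 (n * (4 * L k)) ⟩
  n * (4 * L k) * 3           ≡⟨ ℕ.*-assoc n (4 * L k) 3 ⟩
  n * (4 * L k * 3)           ≡⟨ ≡.cong (n *_) (≡.trans (ℕ.*-comm (4 * L k) 3) (≡.sym (ℕ.*-assoc 3 4 (L k)))) ⟩
  n * (12 * L k)              ≤⟨ ℕ.*-monoʳ-≤ n s≤m ⟩
  n * m ∎
  where
  open ℕ.≤-Reasoning
  q = quota J L nz k

length-cartesianProductWith : ∀ {a b c} {A : Set a} {B : Set b} {C : Set c} (f : A → B → C) xs ys →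
  length (cartesianProductWith f xs ys) ≡ length xs * length ys
length-cartesianProductWith f []       ys = ≡.refl
length-cartesianProductWith f (x ∷ xs) ys = ≡.trans (length-++ (map (f x) ys))
  (≡.cong₂ ℕ._+_ (length-map (f x) ys) (length-cartesianProductWith f xs ys))

-- These exponents index the vanishing conditions imposed at each joint.
grid : ∀ n → (Fin n → ℕ) → List (Vec ℕ n)
grid zero    s = [] ∷ []
grid (suc n) s = cartesianProductWith _∷_ (upTo (s zero)) (grid n (s ∘ suc))

∈-grid : ∀ {n} s (e : Vec ℕ n) → (∀ k → Vec.lookup e k < s k) → e ∈ grid n s
∈-grid s []      p = here ≡.refl
∈-grid s (x ∷ e) p = ∈-cartesianProductWith⁺ _∷_ (∈-upTo⁺ (p zero)) (∈-grid (s ∘ suc) e (p ∘ suc))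

length-grid₃ : ∀ s → length (grid 3 s) ≡ s zero * (s (suc zero) * (s (suc (suc zero)) * 1))
length-grid₃ s = step 2 s (step 1 (s ∘ suc) (step 0 (λ k → s (suc (suc k))) ≡.refl))
  where
  step : ∀ n s {m} → length (grid n (s ∘ suc)) ≡ m → length (grid (suc n) s) ≡ s zero * m
  step n s ≡.refl = ≡.trans (length-cartesianProductWith _∷_ (upTo (s zero)) (grid n (s ∘ suc)))
    (≡.cong (_* length (grid n (s ∘ suc))) (length-upTo (s zero)))

-- Parameter counting and the bound for joints.

module Bound {a ℓ : Level} (F : Field a ℓ) (𝔏 : Fin 3 → List (Geometry.Line F)) where
  open Field F using (_≈_; 0#)
  open Geometry F
  open Polynomials F
  open Substitutions F
  open LinearAlgebra F
  open Joints F 𝔏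
  open Joint

  Distinct : Joint → Joint → Set ℓ
  Distinct i j = ¬ (point i ≋ point j)

  -- Each joint imposes one condition per exponent of the grid on the (e + 1)³ coefficients of a
  -- polynomial of degree at most `e` in each variable; a nontrivial solution contradicts `low⇒𝟘`.
  -- The negated conclusion permits the use of the doubly negated `common-zero`.
  few-rich-joints : ∀ e (js : List Joint) → AllPairs Distinct js → 0 < length js → (s : Fin 3 → ℕ) →
    (∀ {j} → j ∈ js → ∀ k {m} → s k ≤ m → 3 * e < length (companions js k (index j k)) * m) →
    ¬ (length js * length (grid 3 s) < suc e ^ 3)
  few-rich-joints e [] _ () s rich lt
  few-rich-joints e js@(_ ∷ _) distinct _ s rich lt = common-zero conditions
    (≡.subst (_< suc e ^ 3) (≡.sym (length-cartesianProductWith condition js (grid 3 s))) lt)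
    λ { (c , c≉0 , zeros) → c≉0 (box-𝟘 3 c (low⇒𝟘 js distinct (3 * e) s rich (box 3 c) (box-degree 3 c)
      (λ {j} j∈ v v<s → All.lookup zeros (∈-cartesianProductWith⁺ condition j∈ (∈-grid s v v<s)))
      (here ≡.refl))) }
    where
    open Box (suc e)
    condition : Joint → Vec ℕ 3 → LinearForm (suc e ^ 3)
    condition j v = coef-form 3 (subst (frame j)) (subst-linear (frame j)) v
    conditions = cartesianProductWith condition js (grid 3 s)

  joint-bound : (js : List Joint) → AllPairs Distinct js →
    length js ^ 2 ≤ 1728 * (L zero * L (suc zero) * L (suc (suc zero)))
  joint-bound [] _ = z≤n
  joint-bound js@(j₀ ∷ js′) distinct = decidable-stable (_ ℕ.≤? _) λ J²≰ →
    -- `length js′` is J - 1, so the box has side exactly J.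
    few-rich-joints (length js′) kept pruned-distinct nonempty (λ k → 12 * L k) rich′ (small (ℕ.≰⇒> J²≰))
    where
    J = length js
    -- No family is empty, because `j₀` has a line in each.
    nz : ∀ k → NonZero (4 * L k)
    nz k = ℕ.m*n≢0 4 (L k) {{_}} {{Fin.nonZeroIndex (index j₀ k)}}
    θ : Fin 3 → ℕ
    θ = quota J L nz
    open Pruning {A = Joint} {K = Σ (Fin 3) (Fin ∘ L)} {_~_ = λ j c → index j (proj₁ c) ≡ proj₂ c}
      (λ j c → index j (proj₁ c) Fin.≟ proj₂ c) (θ ∘ proj₁)
    open Pruned (prune (length (colours L)) (colours L) ≡.refl js distinct
      (λ _ c _ → ∈-colours L c) (sum-quota J L nz (s≤s z≤n)))
      renaming (distinct to pruned-distinct)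
    rich′ : ∀ {j} → j ∈ kept → ∀ k {m} → 12 * L k ≤ m →
      3 * length js′ < length (companions kept k (index j k)) * m
    rich′ {j} j∈ k {m} s≤m = ℕ.<-≤-trans
      (≡.subst (λ x → length js′ ℕ.+ (length js′ ℕ.+ x) < J ℕ.+ (J ℕ.+ J)) (≡.sym (ℕ.+-identityʳ _))
        (ℕ.+-mono-< (ℕ.n<1+n _) (ℕ.+-mono-< (ℕ.n<1+n _) (ℕ.n<1+n _))))
      (quota-rich J L nz k (rich j∈ (k , index j k) ≡.refl) s≤m)
    N = L zero * L (suc zero) * L (suc (suc zero))
    regroup : ∀ x y z → 12 * x * (12 * y * (12 * z * 1)) ≡ 1728 * (x * y * z)
    regroup = solve 3 (λ x y z → con 12 :* x :* (con 12 :* y :* (con 12 :* z :* con 1)) := con 1728 :* (x :* y :* z)) ≡.refl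
      where open import Data.Nat.Solver; open +-*-Solver
    -- There are 12³ N = 1728 N conditions for each of at most J joints, fewer than J³ in total when
    -- 1728 N is below J².
    small : 1728 * N < J ^ 2 → length kept * length (grid 3 (λ k → 12 * L k)) < J ^ 3
    small lt = ℕ.≤-<-trans (ℕ.*-mono-≤ size (ℕ.≤-reflexive
        (≡.trans (length-grid₃ (λ k → 12 * L k)) (regroup (L zero) (L (suc zero)) (L (suc (suc zero)))))))
      (ℕ.*-monoʳ-< J lt)

-- Multijoints turned into joints.

three : ∀ {a} {A : Set a} → A → A → A → Fin 3 → A
three x y z zero             = x
three x y z (suc zero)       = y
three x y z (suc (suc zero)) = z

module _ {a ℓ : Level} (F : Field a ℓ) (𝔏₁ 𝔏₂ 𝔏₃ : List (Geometry.Line F)) where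
  open Field F hiding (zero) renaming (_*_ to _·_)
  open Geometry F
  open Joints F (three 𝔏₁ 𝔏₂ 𝔏₃)
  open Bound F (three 𝔏₁ 𝔏₂ 𝔏₃)
  open Joint

  toJoint : ∀ x → IsMultijoint 𝔏₁ 𝔏₂ 𝔏₃ x → Σ Joint λ j → point j ≡ x
  toJoint x (l₁ , l₂ , l₃ , l₁∈ , l₂∈ , l₃∈ , x∈₁ , x∈₂ , x∈₃ , sp) = record
    { point     = x
    ; index     = λ { zero → Any.index l₁∈ ; (suc zero) → Any.index l₂∈ ; (suc (suc zero)) → Any.index l₃∈ }
    ; incidence = λ { zero → ≡.subst (x ∈L_) (lookup-index l₁∈) x∈₁
                    ; (suc zero) → ≡.subst (x ∈L_) (lookup-index l₂∈) x∈₂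
                    ; (suc (suc zero)) → ≡.subst (x ∈L_) (lookup-index l₃∈) x∈₃ }
    ; spanning  = λ z → let α , β , γ , p = sp z in three α β γ , λ i → trans (p i)
        (+-cong (swap l₁∈ α i) (+-cong (swap l₂∈ β i) (trans (swap l₃∈ γ i) (sym (+-identityʳ _)))))
    } , ≡.refl
    where
    swap : ∀ {l ls} (l∈ : l ∈ ls) α i → α · dir l i ≈ dir (List.lookup ls (Any.index l∈)) i · α
    swap l∈ α i = trans (*-comm _ _) (*-congʳ (reflexive (≡.cong (λ l → dir l i) (lookup-index l∈))))

  -- Recording the points as an equation of lists carries over both the length and the pairwise
  -- distinctness.
  toJoints : ∀ xs → All (IsMultijoint 𝔏₁ 𝔏₂ 𝔏₃) xs → Σ (List Joint) λ js → map point js ≡ xs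
  toJoints [] [] = [] , ≡.refl
  toJoints (x ∷ xs) (p ∷ ps) =
    let j , eq = toJoint x p ; js , eqs = toJoints xs ps in j ∷ js , ≡.cong₂ _∷_ eq eqs

theorem1 : ∃ℕω λ c → ∀ {a ℓ : Level} (F : Field a ℓ) →
    let open Geometry F in
    (𝔏₁ 𝔏₂ 𝔏₃ : List Line) (xs : List Vec3) →
    AllPairs (λ x y → ¬ (x ≋ y)) xs →
    All (IsMultijoint 𝔏₁ 𝔏₂ 𝔏₃) xs →
    length xs ^ 2 ≤ c * (length 𝔏₁ * length 𝔏₂ * length 𝔏₃)
theorem1 = 1728 ,ω λ F 𝔏₁ 𝔏₂ 𝔏₃ xs distinct multijoints →
  let js , eq = toJoints F 𝔏₁ 𝔏₂ 𝔏₃ xs multijoints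
      open Joints F (three 𝔏₁ 𝔏₂ 𝔏₃)
      open Bound F (three 𝔏₁ 𝔏₂ 𝔏₃)
  in ≡.subst (λ n → n ^ 2 ≤ 1728 * (length 𝔏₁ * length 𝔏₂ * length 𝔏₃))
       (≡.trans (≡.sym (length-map Joint.point js)) (≡.cong length eq))
       (joint-bound js (AllPairs.map⁻ (≡.subst (AllPairs _) (≡.sym eq) distinct)))
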